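{- Let $n\geq 1$ and let $h,k$ be nonnegative integers. If $n$ is odd, then $$D_q(h+n,k+n)\equiv D_q(h+n,k)+D_q(h,k+n)+D_q(h,k)\pmod{\Phi_n(q)},$$ and if $n$ is even, then $$D_q(h+n,k+n)\equiv D_q(h+n,k)+D_q(h,k+n)-D_q(h,k)\pmod{\Phi_n(q)},$$ where the congruences are in $\mathbb{Z}[q]$.
   Context: $\Phi_n(q)$ denotes the $n$-th cyclotomic polynomial. The $q$-integer is $[m]_q=(1-q^m)/(1-q)$ and the $q$-binomial coefficient is $\left[{h\atop k}\right]_q=\frac{[h]_q[h-1]_q\cdots[h-k+1]_q}{[k]_q[k-1]_q\cdots[1]_q}$, with $\left[{h\atop 0}\right]_q=1$ and $\left[{h\atop k}\right]_q=0$ for $k<0$. For nonnegative integers $h,k$ the $q$-Delannoy number is $D_q(h,k)=\sum_{j=0}^{h}q^{\binom{j+1}{2}}\left[{k\atop j}\right]_q\left[{h+k-j\atop k}\right]_q$. -}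

module Defs where

open import Data.Nat as ℕ using (ℕ; zero; suc; _∸_)
open import Data.Nat.Divisibility using (_∣?_)
open import Data.Nat.Combinatorics using (_C_)
open import Data.Integer as ℤ using (ℤ; +_; -_)
open import Data.List using (List; []; _∷_; _++_; reverse; length; [_])
open import Data.List.Relation.Unary.All using (All)
open import Data.Product using (∃-syntax)
open import Relation.Binary.PropositionalEquality using (_≡_)
open import Relation.Nullary.Decidable using (yes; no)

-- Polynomials in ℤ[q]: little-endian coefficient lists
-- (the list a₀ ∷ a₁ ∷ … represents a₀ + a₁ q + …).
Poly : Set
Poly = List ℤ

0ₚ : Poly
0ₚ = []

1ₚ : Poly
1ₚ = + 1 ∷ []

infixl 6 _+ₚ_ _-ₚ_
infixl 7 _*ₚ_ _·ₚ_

_+ₚ_ : Poly → Poly → Poly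
[] +ₚ q = q
(a ∷ p) +ₚ [] = a ∷ p
(a ∷ p) +ₚ (b ∷ q) = (a ℤ.+ b) ∷ (p +ₚ q)

-ₚ_ : Poly → Poly
-ₚ [] = []
-ₚ (a ∷ p) = (- a) ∷ (-ₚ p)

_-ₚ_ : Poly → Poly → Poly
p -ₚ q = p +ₚ (-ₚ q)

_·ₚ_ : ℤ → Poly → Poly
c ·ₚ [] = []
c ·ₚ (a ∷ p) = (c ℤ.* a) ∷ (c ·ₚ p)

_*ₚ_ : Poly → Poly → Poly
[] *ₚ q = []
(a ∷ p) *ₚ q = (a ·ₚ q) +ₚ (+ 0 ∷ (p *ₚ q))

qpow : ℕ → Poly
qpow zero = 1ₚ
qpow (suc m) = + 0 ∷ qpow m

IsZero : Poly → Set
IsZero p = All (_≡ + 0) p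

infix 4 _∣ₚ_
_∣ₚ_ : Poly → Poly → Set
P ∣ₚ A = ∃[ C ] IsZero (A -ₚ P *ₚ C)

infix 4 _≡_[modₚ_]
_≡_[modₚ_] : Poly → Poly → Poly → Set
A ≡ B [modₚ P ] = P ∣ₚ (A -ₚ B)

-- drop trailing zero coefficients (leading zeros of the big-endian form)
private
  dropZerosBE : List ℤ → List ℤ
  dropZerosBE [] = []
  dropZerosBE (+ zero ∷ xs) = dropZerosBE xs
  dropZerosBE (x ∷ xs) = x ∷ xs

  -- subtract c·B from the front of A (big-endian), A at least as long as B
  subFront : List ℤ → List ℤ → ℤ → List ℤ
  subFront as [] c = as
  subFront [] (b ∷ bs) c = []
  subFront (a ∷ as) (b ∷ bs) c = (a ℤ.- c ℤ.* b) ∷ subFront as bs c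

  -- big-endian long division by monic B (big-endian, leading coeff 1),
  -- with fuel; returns the big-endian quotient
  divBE : ℕ → List ℤ → List ℤ → List ℤ
  divBE zero A B = []
  divBE (suc f) [] B = []
  divBE (suc f) (a ∷ as) B with length B ℕ.≤? suc (length as)
  ... | no _ = []
  ... | yes _ with subFront (a ∷ as) B a
  ...   | [] = a ∷ []
  ...   | _ ∷ rest = a ∷ divBE f rest B

-- quotient of A by a monic polynomial B
quotₚ : Poly → Poly → Poly
quotₚ A B = reverse (divBE (length A) (reverse A) (dropZerosBE (reverse B)))

-- q-integers and q-binomial coefficients (as in the paper: a ratio of
-- products of q-integers; the denominator is monic, the division exact).

qint : ℕ → Poly
qint zero = 0ₚ
qint (suc m) = + 1 ∷ qint m

fallingQ : ℕ → ℕ → Poly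
fallingQ h zero = 1ₚ
fallingQ h (suc k) = qint (h ∸ k) *ₚ fallingQ h k

qfact : ℕ → Poly
qfact zero = 1ₚ
qfact (suc k) = qint (suc k) *ₚ qfact k

qbinom : ℕ → ℕ → Poly
qbinom h k = quotₚ (fallingQ h k) (qfact k)

sumTo : ℕ → (ℕ → Poly) → Poly
sumTo zero f = f zero
sumTo (suc h) f = sumTo h f +ₚ f (suc h)

Dq : ℕ → ℕ → Poly
Dq h k = sumTo h (λ j → qpow (suc j C 2) *ₚ qbinom k j *ₚ qbinom (h ℕ.+ k ∸ j) k)

-- Cyclotomic polynomials, via  q^n - 1 = ∏_{d ∣ n} Φ_d(q),  i.e.
--   Φ_n = (q^n - 1) / ∏_{d ∣ n, d < n} Φ_d   (n ≥ 1).
-- (Φ_0 is meaningless; this gives 0 there and is never used.)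

private
  lookupD : List Poly → ℕ → Poly
  lookupD [] i = 1ₚ
  lookupD (p ∷ ps) zero = p
  lookupD (p ∷ ps) (suc i) = lookupD ps i

  properDivProd : ℕ → List Poly → ℕ → Poly
  properDivProd n ps zero = 1ₚ
  properDivProd n ps (suc d) with suc d ∣? n
  ... | yes _ = lookupD ps (suc d) *ₚ properDivProd n ps d
  ... | no _ = properDivProd n ps d

  phiFrom : ℕ → List Poly → Poly
  phiFrom n ps = quotₚ (qpow n -ₚ 1ₚ) (properDivProd n ps (n ∸ 1))

  phis : ℕ → List Poly
  phis zero = []
  phis (suc n) = phis n ++ [ phiFrom n (phis n) ]

Φ : ℕ → Poly
Φ n = phiFrom n (phis n)

{-# OPTIONS --safe #-}

-- The numbers D_q(h, k), h ≥ 0, have the generating series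
--   F_k(x) = (1 + q x)⋯(1 + q^k x) / ((1 − x)(1 − q x)⋯(1 − q^k x)),
-- so F_(k+n)(x) · ∏_(i = k+1..k+n) (1 − q^i x) = F_k(x) · ∏_(i = k+1..k+n) (1 + q^i x).
-- Modulo Φ_n one has q^n = 1, and q^j − 1 is not a zero divisor for 0 < j < n.
-- The functional equation of ∏ (1 + q^i x) under x ↦ q x then kills its middle
-- coefficients, the two products become 1 − x^n and 1 − (−x)^n, and comparing
-- the coefficients of x^(h+n) gives the congruences.
-- That q^j − 1 is regular modulo Φ_n is proved together with
-- q^n − 1 = ∏_(d ∣ n) Φ_d by strong induction: it makes the Φ_d with d < n
-- coprime enough for their product to divide q^n − 1, and for g ∣ n, g < n,
-- Φ_n divides (q^n − 1)/(q^g − 1), which is n/g modulo q^g − 1.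
module Submission where

open import Defs
open import Algebra.Bundles using (CommutativeRing)
open import Algebra.Structures using (IsCommutativeRing)
open import Data.Empty using (⊥-elim)
open import Data.Integer as ℤ using (ℤ; +_)
open import Data.List using (List; []; _∷_; _++_; reverse; length; [_])
open import Data.List.Properties using (length-++; length-reverse; reverse-involutive; unfold-reverse)
open import Data.List.Relation.Unary.All using ([]; _∷_)
open import Data.Maybe using (Maybe; just; nothing)
open import Data.Nat as ℕ using (ℕ; zero; suc; _≤_; _<_; z≤n; s≤s; _∸_)
open import Data.Nat.Combinatorics using (_C_; nCk+nC[k+1]≡[n+1]C[k+1]; nC1≡n)
open import Data.Nat.DivMod using (m≡m%n+[m/n]*n)
open import Data.Nat.Divisibility using (_∣_; divides; _∣?_; ∣⇒≤; ∣-refl; ∣-trans; 0∣⇒≡0)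
open import Data.Nat.GCD using (module GCD; module Bézout)
open import Data.Nat.Induction using (<-rec)
open import Data.Product using (_×_; _,_; proj₁; proj₂; ∃-syntax)
open import Data.Sum using (inj₁; inj₂)
open import Level using (0ℓ)
open import Relation.Binary.Definitions using (tri<; tri≈; tri>)
open import Relation.Binary.PropositionalEquality as ≡ using (_≡_; _≢_)
open import Relation.Binary.Structures using (IsEquivalence)
open import Relation.Nullary using (¬_; Dec; yes; no)
open import Tactic.RingSolver using (solve-∀)
open import Tactic.RingSolver.Core.AlmostCommutativeRing using (AlmostCommutativeRing; fromCommutativeRing)
import Algebra.Properties.CommutativeSemiring.Exp
import Algebra.Properties.Ring
import Algebra.Solver.Ring.NaturalCoefficients.Default
import Data.Integer.Properties as ℤ
import Data.Integer.Tactic.RingSolver as ℤ-Solver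
import Data.Nat.Properties as ℕ
import Data.Nat.Tactic.RingSolver as ℕ-Solver
import Relation.Binary.Reasoning.Setoid

-- The series argument runs over an arbitrary commutative ring with an element q such that q^n = 1
-- and q^j - 1 cancels for 0 < j < n; the quotient by Φ_n is substituted only at the end. The
-- obstacle is Φ_n itself: it is the output of long division on coefficient lists, so nothing is
-- known about it before that division is known to be exact. Exactness at n rests on regularity
-- modulo the smaller Φ_d, and regularity modulo Φ_n rests on the factorisation at n, which is why
-- both go through one induction. Over ℤ the number n/g is not invertible; it is cancelled because
-- Φ_n is monic. Monicity stands in for a field throughout: it yields cancellation, uniqueness of
-- quotients and the absence of integer torsion in ℤ[q]/Φ_n.

triangle-suc : ∀ j → suc (suc j) C 2 ≡ suc j ℕ.+ suc j C 2
triangle-suc j = ≡.trans (≡.sym (nCk+nC[k+1]≡[n+1]C[k+1] (suc j) 1)) (≡.cong (ℕ._+ suc j C 2) (nC1≡n (suc j)))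

-- In the shape n · m + m with n = 2m, so that q^n = 1 reduces the corresponding power of q to q^m.
triangle-even : ∀ m → suc (m ℕ.* 2) C 2 ≡ m ℕ.* 2 ℕ.* m ℕ.+ m
triangle-even zero    = ≡.refl
triangle-even (suc m) = ≡.trans (triangle-suc (suc (m ℕ.* 2)))
  (≡.trans (≡.cong (suc (suc (m ℕ.* 2)) ℕ.+_) (≡.trans (triangle-suc (m ℕ.* 2)) (≡.cong (suc (m ℕ.* 2) ℕ.+_) (triangle-even m))))
           (lemma m))
  where
  lemma : ∀ m → suc (suc (m ℕ.* 2)) ℕ.+ (suc (m ℕ.* 2) ℕ.+ (m ℕ.* 2 ℕ.* m ℕ.+ m)) ≡ suc m ℕ.* 2 ℕ.* suc m ℕ.+ suc m
  lemma = ℕ-Solver.solve-∀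

-- Sequences as formal power series

module Sequences {c ℓ} (R : CommutativeRing c ℓ) where
  open CommutativeRing R hiding (zero)
  open Relation.Binary.Reasoning.Setoid setoid
  open Algebra.Solver.Ring.NaturalCoefficients.Default commutativeSemiring

  Seq : Set c
  Seq = ℕ → Carrier

  sum≤ : ℕ → Seq → Carrier
  sum≤ zero    f = f zero
  sum≤ (suc m) f = sum≤ m f + f (suc m)

  shift : Seq → Seq
  shift f zero    = 0#
  shift f (suc m) = f m

  -- Multiplication of the generating series by 1 + a x.
  step : Carrier → Seq → Seq
  step a f m = f m + a * shift f m

  conv : Seq → Seq → Seq
  conv f g m = sum≤ m (λ j → f j * g (m ∸ j))

  sum≤-cong : ∀ m {f g : Seq} → (∀ j → j ≤ m → f j ≈ g j) → sum≤ m f ≈ sum≤ m g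
  sum≤-cong zero    e = e zero z≤n
  sum≤-cong (suc m) e = +-cong (sum≤-cong m (λ j j≤m → e j (ℕ.m≤n⇒m≤1+n j≤m))) (e (suc m) ℕ.≤-refl)

  sum≤-peel : ∀ m (f : Seq) → sum≤ (suc m) f ≈ f 0 + sum≤ m (λ j → f (suc j))
  sum≤-peel zero    f = refl
  sum≤-peel (suc m) f = trans (+-congʳ (sum≤-peel m f)) (+-assoc _ _ _)

  sum≤-+ : ∀ m (f g : Seq) → sum≤ m (λ j → f j + g j) ≈ sum≤ m f + sum≤ m g
  sum≤-+ zero    f g = refl
  sum≤-+ (suc m) f g = trans (+-congʳ (sum≤-+ m f g))
    (solve 4 (λ a b c d → (a :+ b) :+ (c :+ d) := (a :+ c) :+ (b :+ d)) refl _ _ _ _)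

  sum≤-* : ∀ a m (f : Seq) → sum≤ m (λ j → a * f j) ≈ a * sum≤ m f
  sum≤-* a zero    f = refl
  sum≤-* a (suc m) f = trans (+-congʳ (sum≤-* a m f)) (sym (distribˡ a _ _))

  sum≤-first : ∀ m (f : Seq) → (∀ j → 0 < j → j ≤ m → f j ≈ 0#) → sum≤ m f ≈ f 0
  sum≤-first zero    f z = refl
  sum≤-first (suc m) f z = trans
    (+-cong (sum≤-first m f (λ j 0<j j≤m → z j 0<j (ℕ.m≤n⇒m≤1+n j≤m))) (z (suc m) (s≤s z≤n) ℕ.≤-refl))
    (+-identityʳ _)

  sum≤-two : ∀ m n (f : Seq) → 0 < n → n ≤ m → (∀ j → 0 < j → j ≢ n → f j ≈ 0#) →
             sum≤ m f ≈ f 0 + f n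
  sum≤-two zero    (suc n) f 0<n () z
  sum≤-two (suc m) n f 0<n n≤m z with n ℕ.≟ suc m
  ... | yes ≡.refl = +-congʳ (sum≤-first m f (λ j 0<j j≤m → z j 0<j (ℕ.<⇒≢ (s≤s j≤m))))
  ... | no n≢ = trans
    (+-cong (sum≤-two m n f 0<n (ℕ.≤-pred (ℕ.≤∧≢⇒< n≤m n≢)) z) (z (suc m) (s≤s z≤n) (λ e → n≢ (≡.sym e))))
    (+-identityʳ _)

  shift-cong : ∀ {f g : Seq} → (∀ m → f m ≈ g m) → ∀ m → shift f m ≈ shift g m
  shift-cong e zero    = refl
  shift-cong e (suc m) = e m

  step-cong : ∀ {a b} {f g : Seq} → a ≈ b → (∀ m → f m ≈ g m) → ∀ m → step a f m ≈ step b g m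
  step-cong a≈b e m = +-cong (e m) (*-cong a≈b (shift-cong e m))

  step-comm : ∀ a b f m → step a (step b f) m ≈ step b (step a f) m
  step-comm a b f zero    = solve 3 (λ a b x → (x :+ b :* con 0) :+ a :* con 0 := (x :+ a :* con 0) :+ b :* con 0) refl a b (f 0)
  step-comm a b f (suc m) =
    solve 5 (λ a b x y z → (x :+ b :* y) :+ a :* (y :+ b :* z) := (x :+ a :* y) :+ b :* (y :+ a :* z))
      refl a b (f (suc m)) (f m) (shift f m)

  conv-cong : ∀ {f f′ g g′ : Seq} → (∀ m → f m ≈ f′ m) → (∀ m → g m ≈ g′ m) →
              ∀ m → conv f g m ≈ conv f′ g′ m
  conv-cong e e′ m = sum≤-cong m (λ j _ → *-cong (e j) (e′ (m ∸ j)))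

  conv-shiftˡ : ∀ f g m → conv (shift f) g m ≈ shift (conv f g) m
  conv-shiftˡ f g zero    = zeroˡ _
  conv-shiftˡ f g (suc m) = trans (sum≤-peel m _) (trans (+-congʳ (zeroˡ _)) (+-identityˡ _))

  conv-shiftʳ : ∀ f g m → conv f (shift g) m ≈ shift (conv f g) m
  conv-shiftʳ f g zero    = zeroʳ _
  conv-shiftʳ f g (suc m) = begin
    sum≤ m (λ j → f j * shift g (suc m ∸ j)) + f (suc m) * shift g (m ∸ m)
      -- Subtraction is truncated: only j ≤ m makes `suc m ∸ j` a successor, on which `shift`
      -- reduces. The last term is `shift g 0`, which is 0.
      ≈⟨ +-cong (sum≤-cong m (λ j j≤m → *-congˡ (reflexive (≡.cong (shift g) (ℕ.+-∸-assoc 1 j≤m)))))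
                (*-congˡ (reflexive (≡.cong (shift g) (ℕ.n∸n≡0 m)))) ⟩
    conv f g m + f (suc m) * 0#
      ≈⟨ trans (+-congˡ (zeroʳ _)) (+-identityʳ _) ⟩
    conv f g m ∎

  conv-stepˡ : ∀ a f g m → conv (step a f) g m ≈ step a (conv f g) m
  conv-stepˡ a f g m = begin
    sum≤ m (λ j → (f j + a * shift f j) * g (m ∸ j))
      ≈⟨ sum≤-cong m (λ j _ → solve 4 (λ a x y z → (x :+ a :* y) :* z := x :* z :+ a :* (y :* z)) refl a _ _ _) ⟩
    sum≤ m (λ j → f j * g (m ∸ j) + a * (shift f j * g (m ∸ j)))
      ≈⟨ trans (sum≤-+ m _ _) (+-congˡ (sum≤-* a m _)) ⟩
    conv f g m + a * conv (shift f) g m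
      ≈⟨ +-congˡ (*-congˡ (conv-shiftˡ f g m)) ⟩
    step a (conv f g) m ∎

  conv-stepʳ : ∀ a f g m → conv f (step a g) m ≈ step a (conv f g) m
  conv-stepʳ a f g m = begin
    sum≤ m (λ j → f j * (g (m ∸ j) + a * shift g (m ∸ j)))
      ≈⟨ sum≤-cong m (λ j _ → solve 4 (λ a x y z → x :* (y :+ a :* z) := x :* y :+ a :* (x :* z)) refl a _ _ _) ⟩
    sum≤ m (λ j → f j * g (m ∸ j) + a * (f j * shift g (m ∸ j)))
      ≈⟨ trans (sum≤-+ m _ _) (+-congˡ (sum≤-* a m _)) ⟩
    conv f g m + a * conv f (shift g) m
      ≈⟨ +-congˡ (*-congˡ (conv-shiftʳ f g m)) ⟩
    step a (conv f g) m ∎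

  conv-two-terms : ∀ n (e f : Seq) → 0 < n → e 0 ≈ 1# → (∀ j → 0 < j → j ≢ n → e j ≈ 0#) →
                   ∀ h → conv e f (h ℕ.+ n) ≈ f (h ℕ.+ n) + e n * f h
  conv-two-terms n e f 0<n e₀ e₌ h = begin
    conv e f (h ℕ.+ n)
      ≈⟨ sum≤-two (h ℕ.+ n) n _ 0<n (ℕ.m≤n+m n h) (λ j 0<j j≢n → trans (*-congʳ (e₌ j 0<j j≢n)) (zeroˡ _)) ⟩
    e 0 * f (h ℕ.+ n) + e n * f (h ℕ.+ n ∸ n)
      ≈⟨ +-cong (trans (*-congʳ e₀) (*-identityˡ _)) (*-congˡ (reflexive (≡.cong f (ℕ.m+n∸n≡m h n)))) ⟩
    f (h ℕ.+ n) + e n * f h ∎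

-- Gaussian binomial coefficients

module GaussianBinomials {c ℓ} (R : CommutativeRing c ℓ) (q : CommutativeRing.Carrier R) where
  open CommutativeRing R hiding (zero)
  open Sequences R
  open Relation.Binary.Reasoning.Setoid setoid
  open Algebra.Solver.Ring.NaturalCoefficients.Default commutativeSemiring
  open Algebra.Properties.CommutativeSemiring.Exp commutativeSemiring
  open Algebra.Properties.Ring ring using (-1*x≈-x; -‿distribˡ-*; -‿distribʳ-*; -‿involutive; +-cancelʳ; +-inverseʳ-unique)

  -- A Pascal rule instead of a quotient, so that the coefficients exist in every commutative ring,
  -- including ℤ[q]/Φ_n, where q-factorials can vanish.
  gauss : ℕ → ℕ → Carrier
  gauss k       zero    = 1#
  gauss zero    (suc j) = 0#
  gauss (suc k) (suc j) = gauss k j + q ^ suc j * gauss k (suc j)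

  gauss-above : ∀ {k j} → k < j → gauss k j ≈ 0#
  gauss-above {zero}  {suc j} _         = refl
  gauss-above {suc k} {suc j} (s≤s k<j) = trans
    (+-cong (gauss-above k<j) (*-congˡ (gauss-above (ℕ.m≤n⇒m≤1+n k<j))))
    (trans (+-identityˡ _) (zeroʳ _))

  gauss-diag : ∀ k → gauss k k ≈ 1#
  gauss-diag zero    = refl
  gauss-diag (suc k) = trans (+-cong (gauss-diag k) (trans (*-congˡ (gauss-above (ℕ.n<1+n k))) (zeroʳ _))) (+-identityʳ _)

  -- (1 − q^(j+1)) [k, j+1] = (1 − q^(k−j)) [k, j], multiplied by q^j and
  -- rearranged so that no subtraction occurs.
  gauss-ratio : ∀ k j → q ^ j * gauss k (suc j) + q ^ k * gauss k j
                      ≈ q ^ j * gauss k j + q ^ j * q ^ suc j * gauss k (suc j)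
  gauss-ratio zero zero = solve 1 (λ q → con 1 :* con 0 :+ con 1 :* con 1 := con 1 :* con 1 :+ con 1 :* (q :* con 1) :* con 0) refl q
  gauss-ratio zero (suc j) = solve 2 (λ a b → a :* con 0 :+ con 1 :* con 0 := a :* con 0 :+ a :* b :* con 0) refl _ _
  gauss-ratio (suc k) zero = begin
    1# * (1# + q * 1# * G) + q * q ^ k * 1#
      ≈⟨ solve 3 (λ q G K → con 1 :* (con 1 :+ q :* con 1 :* G) :+ q :* K :* con 1
                         := con 1 :+ q :* (con 1 :* G :+ K :* con 1)) refl q G (q ^ k) ⟩
    1# + q * (1# * G + q ^ k * 1#)
      ≈⟨ +-congˡ (*-congˡ (gauss-ratio k zero)) ⟩
    1# + q * (1# * 1# + 1# * (q * 1#) * G)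
      ≈⟨ solve 2 (λ q G → con 1 :+ q :* (con 1 :* con 1 :+ con 1 :* (q :* con 1) :* G)
                       := con 1 :* con 1 :+ con 1 :* (q :* con 1) :* (con 1 :+ q :* con 1 :* G)) refl q G ⟩
    1# * 1# + 1# * (q * 1#) * (1# + q * 1# * G) ∎
    where G = gauss k 1
  gauss-ratio (suc k) (suc j) = begin
    q * J * (B + q * (q * J) * C′) + q * K * (A + q * J * B)
      ≈⟨ solve 6 (λ q J K A B C → q :* J :* (B :+ q :* (q :* J) :* C) :+ q :* K :* (A :+ q :* J :* B)
           := q :* (J :* B :+ K :* A) :+ q :* (q :* J) :* (q :* J :* C :+ K :* B)) refl q J K A B C′ ⟩
    q * (J * B + K * A) + q * (q * J) * (q * J * C′ + K * B)
      ≈⟨ +-cong (*-congˡ (gauss-ratio k j)) (*-congˡ (gauss-ratio k (suc j))) ⟩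
    q * (J * A + J * (q * J) * B) + q * (q * J) * (q * J * B + q * J * (q * (q * J)) * C′)
      ≈⟨ solve 5 (λ q J A B C → q :* (J :* A :+ J :* (q :* J) :* B) :+ q :* (q :* J) :* (q :* J :* B :+ q :* J :* (q :* (q :* J)) :* C)
           := q :* J :* (A :+ q :* J :* B) :+ q :* J :* (q :* (q :* J)) :* (B :+ q :* (q :* J) :* C)) refl q J A B C′ ⟩
    q * J * (A + q * J * B) + q * J * (q * (q * J)) * (B + q * (q * J) * C′) ∎
    where
    J = q ^ j ; K = q ^ k ; A = gauss k j ; B = gauss k (suc j) ; C′ = gauss k (suc (suc j))

  -- The coefficient of x^j in (1 + q x)(1 + q² x)⋯(1 + q^k x).
  elem : ℕ → ℕ → Carrier
  elem k j = q ^ (suc j C 2) * gauss k j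

  private
    elem-suc : ∀ k j → elem k (suc j) ≈ q ^ suc j * q ^ (suc j C 2) * gauss k (suc j)
    elem-suc k j = *-congʳ (trans (reflexive (≡.cong (q ^_) (triangle-suc j))) (^-homo-* q (suc j) _))

  -- The coefficient of x^(j+1) in the functional equation (1 + q^(k+1) x) E(x) = (1 + q x) E(q x),
  -- where E(x) = (1 + q x)⋯(1 + q^k x).
  elem-ratio : ∀ k j → elem k (suc j) + q ^ suc k * elem k j
                     ≈ q ^ suc j * elem k j + q ^ suc j * elem k (suc j)
  elem-ratio k j = begin
    elem k (suc j) + q * K * (t * A)
      ≈⟨ +-congʳ (elem-suc k j) ⟩
    q * J * t * B + q * K * (t * A)
      ≈⟨ solve 6 (λ q J K t A B → q :* J :* t :* B :+ q :* K :* (t :* A) := q :* t :* (J :* B :+ K :* A)) refl q J K t A B ⟩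
    q * t * (J * B + K * A)
      ≈⟨ *-congˡ (gauss-ratio k j) ⟩
    q * t * (J * A + J * (q * J) * B)
      ≈⟨ solve 5 (λ q J t A B → q :* t :* (J :* A :+ J :* (q :* J) :* B) := q :* J :* (t :* A) :+ q :* J :* (q :* J :* t :* B)) refl q J t A B ⟩
    q * J * (t * A) + q * J * (q * J * t * B)
      ≈⟨ +-congˡ (*-congˡ (elem-suc k j)) ⟨
    q * J * (t * A) + q * J * elem k (suc j) ∎
    where
    J = q ^ j ; K = q ^ k ; A = gauss k j ; B = gauss k (suc j) ; t = q ^ (suc j C 2)

  -- The Pascal rule of `gauss` produces (1 + q x) E(q x), and `elem-ratio` turns this into (1 +
  -- q^(k+1) x) E(x).
  elem-pascal : ∀ k j → elem (suc k) j ≈ step (q ^ suc k) (elem k) j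
  elem-pascal k zero    = solve 1 (λ a → con 1 :* con 1 := con 1 :* con 1 :+ a :* con 0) refl _
  elem-pascal k (suc j) = begin
    elem (suc k) (suc j)
      ≈⟨ elem-suc (suc k) j ⟩
    s * t * (A + s * B)
      ≈⟨ solve 4 (λ s t A B → s :* t :* (A :+ s :* B) := s :* (t :* A) :+ s :* (s :* t :* B)) refl s t A B ⟩
    s * (t * A) + s * (s * t * B)
      ≈⟨ +-congˡ (*-congˡ (elem-suc k j)) ⟨
    s * elem k j + s * elem k (suc j)
      ≈⟨ elem-ratio k j ⟨
    step (q ^ suc k) (elem k) (suc j) ∎
    where
    s = q ^ suc j ; t = q ^ (suc j C 2) ; A = gauss k j ; B = gauss k (suc j)

  elem-scaled-pascal : ∀ a k j → elem (suc k) j * a ^ j ≈ step (a * q ^ suc k) (λ i → elem k i * a ^ i) j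
  elem-scaled-pascal a k zero = trans (*-congʳ (elem-pascal k zero))
    (solve 3 (λ a b x → (x :+ b :* con 0) :* con 1 := x :* con 1 :+ a :* b :* con 0) refl a (q ^ suc k) (elem k 0))
  elem-scaled-pascal a k (suc j) = trans (*-congʳ (elem-pascal k (suc j)))
    (solve 5 (λ a b x y z → (x :+ b :* y) :* (a :* z) := x :* (a :* z) :+ a :* b :* (y :* z))
      refl a (q ^ suc k) (elem k (suc j)) (elem k j) (a ^ j))

  -- The coefficient of x^m in 1 / ((1 − x)(1 − q x)⋯(1 − q^k x)).
  complete : ℕ → ℕ → Carrier
  complete k m = gauss (m ℕ.+ k) k

  private
    x+y-y≈x : ∀ x y → (x + y) + - y ≈ x
    x+y-y≈x x y = trans (+-assoc x y (- y)) (trans (+-congˡ (-‿inverseʳ y)) (+-identityʳ x))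

  -- For m > 0 this is the defining recursion of `gauss`, read as removal of the factor 1 - q^(k+1)
  -- x from the denominator.
  complete-pascal : ∀ k m → step (- q ^ suc k) (complete (suc k)) m ≈ complete k m
  complete-pascal k zero    = trans (+-cong (gauss-diag (suc k)) (zeroʳ _)) (trans (+-identityʳ _) (sym (gauss-diag k)))
  complete-pascal k (suc m) = begin
    gauss (suc m ℕ.+ suc k) (suc k) + - q ^ suc k * X
      ≈⟨ +-cong (+-cong (reflexive (≡.cong (λ i → gauss i k) (ℕ.+-suc m k))) refl) (sym (-‿distribˡ-* _ _)) ⟩
    gauss (suc m ℕ.+ k) k + q ^ suc k * X + - (q ^ suc k * X)
      ≈⟨ x+y-y≈x _ _ ⟩
    gauss (suc m ℕ.+ k) k ∎
    where X = gauss (m ℕ.+ suc k) (suc k)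

  -- The arguments are swapped against D_q: `delannoy k h` is D_q(h, k), so that `delannoy k` is the
  -- coefficient sequence of F_k.
  delannoy : ℕ → ℕ → Carrier
  delannoy k = conv (elem k) (complete k)

  -- Both sides are the numerator of F_(k+1) over the denominator of F_k.
  delannoy-step : ∀ k m → step (- q ^ suc k) (delannoy (suc k)) m ≈ step (q ^ suc k) (delannoy k) m
  delannoy-step k m = begin
    step (- q ^ suc k) (delannoy (suc k)) m
      ≈⟨ conv-stepʳ _ (elem (suc k)) (complete (suc k)) m ⟨
    conv (elem (suc k)) (step (- q ^ suc k) (complete (suc k))) m
      ≈⟨ conv-cong (elem-pascal k) (complete-pascal k) m ⟩
    conv (step (q ^ suc k) (elem k)) (complete k) m
      ≈⟨ conv-stepˡ _ (elem k) (complete k) m ⟩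
    step (q ^ suc k) (delannoy k) m ∎

  -- Multiplication of the generating series by (1 + a q x)⋯(1 + a q^n x).
  steps : ℕ → Carrier → Seq → Seq
  steps zero    a f = f
  steps (suc n) a f = step (a * q ^ suc n) (steps n a f)

  steps-cong : ∀ n a {f g} → (∀ m → f m ≈ g m) → ∀ m → steps n a f m ≈ steps n a g m
  steps-cong zero    a e = e
  steps-cong (suc n) a e = step-cong refl (steps-cong n a e)

  steps-step-comm : ∀ n a b f m → steps n a (step b f) m ≈ step b (steps n a f) m
  steps-step-comm zero    a b f m = refl
  steps-step-comm (suc n) a b f m = trans (step-cong refl (steps-step-comm n a b f) m) (step-comm _ b _ m)

  -- The finite q-binomial theorem, with a x in place of x.
  steps-expand : ∀ n a f m → steps n a f m ≈ conv (λ j → elem n j * a ^ j) f m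
  steps-expand zero a f m = sym (begin
    sum≤ m (λ j → elem 0 j * a ^ j * f (m ∸ j))
      ≈⟨ sum≤-first m _ (λ { (suc j) _ _ → trans (*-congʳ (trans (*-congʳ (zeroʳ _)) (zeroˡ _))) (zeroˡ _) }) ⟩
    1# * 1# * 1# * f m
      ≈⟨ solve 1 (λ x → con 1 :* con 1 :* con 1 :* x := x) refl (f m) ⟩
    f m ∎)
  steps-expand (suc n) a f m = begin
    step (a * q ^ suc n) (steps n a f) m
      ≈⟨ step-cong refl (steps-expand n a f) m ⟩
    step (a * q ^ suc n) (conv (λ j → elem n j * a ^ j) f) m
      ≈⟨ conv-stepˡ _ _ f m ⟨
    conv (step (a * q ^ suc n) (λ j → elem n j * a ^ j)) f m
      ≈⟨ conv-cong {g = f} (λ j → sym (elem-scaled-pascal a n j)) (λ _ → refl) m ⟩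
    conv (λ j → elem (suc n) j * a ^ j) f m ∎

  1^n≈1 : ∀ m → 1# ^ m ≈ 1#
  1^n≈1 zero    = refl
  1^n≈1 (suc m) = trans (*-identityˡ _) (1^n≈1 m)

  -‿^-even : ∀ x m → (- x) ^ (m ℕ.* 2) ≈ x ^ (m ℕ.* 2)
  -‿^-even x zero    = refl
  -‿^-even x (suc m) = begin
    - x * (- x * (- x) ^ (m ℕ.* 2))  ≈⟨ -‿distribˡ-* _ _ ⟨
    - (x * (- x * (- x) ^ (m ℕ.* 2)))  ≈⟨ -‿cong (*-congˡ (-‿distribˡ-* _ _)) ⟨
    - (x * - (x * (- x) ^ (m ℕ.* 2)))  ≈⟨ -‿cong (-‿distribʳ-* _ _) ⟨
    - - (x * (x * (- x) ^ (m ℕ.* 2)))  ≈⟨ -‿involutive _ ⟩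
    x * (x * (- x) ^ (m ℕ.* 2))  ≈⟨ *-congˡ (*-congˡ (-‿^-even x m)) ⟩
    x * (x * x ^ (m ℕ.* 2)) ∎

  -‿^-odd : ∀ x m → (- x) ^ suc (m ℕ.* 2) ≈ - (x ^ suc (m ℕ.* 2))
  -‿^-odd x m = trans (sym (-‿distribˡ-* _ _)) (-‿cong (*-congˡ (-‿^-even x m)))

  x-y≈z⇒x≈z+y : ∀ {x y z} → x + - y ≈ z → x ≈ z + y
  x-y≈z⇒x≈z+y {x} {y} {z} e = begin
    x               ≈⟨ +-identityʳ x ⟨
    x + 0#          ≈⟨ +-congˡ (-‿inverseˡ y) ⟨
    x + (- y + y)   ≈⟨ +-assoc x (- y) y ⟨
    x + - y + y     ≈⟨ +-congʳ e ⟩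
    z + y ∎

  -- Consequences of the functional equation when q^n = 1

  module _ (F : ℕ → Seq) (F-step : ∀ k m → step (- q ^ suc k) (F (suc k)) m ≈ step (q ^ suc k) (F k) m) where

    -- For a = ∓q^k the factors are 1 ∓ q^i x with i = k+1..k+n. The outermost one is commuted
    -- inwards, exchanged by `F-step` at k + n, and commuted back out.
    steps-telescope : ∀ n k m → steps n (- q ^ k) (F (k ℕ.+ n)) m ≈ steps n (q ^ k) (F k) m
    steps-telescope zero    k m = reflexive (≡.cong (λ i → F i m) (ℕ.+-identityʳ k))
    steps-telescope (suc n) k m = begin
      step (- q ^ k * q ^ suc n) (steps n (- q ^ k) (F (k ℕ.+ suc n))) m
        ≈⟨ step-cong (trans (sym (-‿distribˡ-* _ _)) (-‿cong pow)) (λ _ → refl) m ⟩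
      step (- q ^ suc (k ℕ.+ n)) (steps n (- q ^ k) (F (k ℕ.+ suc n))) m
        ≈⟨ steps-step-comm n _ _ _ m ⟨
      steps n (- q ^ k) (step (- q ^ suc (k ℕ.+ n)) (F (k ℕ.+ suc n))) m
        ≈⟨ steps-cong n _ (λ i → trans (reflexive (≡.cong (λ l → step (- q ^ suc (k ℕ.+ n)) (F l) i) (ℕ.+-suc k n)))
                                       (F-step (k ℕ.+ n) i)) m ⟩
      steps n (- q ^ k) (step (q ^ suc (k ℕ.+ n)) (F (k ℕ.+ n))) m
        ≈⟨ steps-step-comm n _ _ _ m ⟩
      step (q ^ suc (k ℕ.+ n)) (steps n (- q ^ k) (F (k ℕ.+ n))) m
        ≈⟨ step-cong (sym pow) (steps-telescope n k) m ⟩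
      step (q ^ k * q ^ suc n) (steps n (q ^ k) (F k)) m ∎
      where
      pow : q ^ k * q ^ suc n ≈ q ^ suc (k ℕ.+ n)
      pow = trans (sym (^-homo-* q k (suc n))) (reflexive (≡.cong (q ^_) (ℕ.+-suc k n)))

    -- `fixed⇒0` is the regularity of q^j - 1, phrased without subtraction.
    module RootOfUnity (n : ℕ) (0<n : 0 < n) (qⁿ≈1 : q ^ n ≈ 1#)
      (fixed⇒0 : ∀ j c → 0 < j → j < n → q ^ j * c ≈ c → c ≈ 0#) where

      -- Once the two multiples of e_j in `elem-ratio` agree, what is left says that q^(j+1) fixes
      -- e_(j+1).
      elem-next : ∀ j → suc j < n → q ^ suc n * elem n j ≈ q ^ suc j * elem n j → elem n (suc j) ≈ 0#
      elem-next j j<n e = fixed⇒0 (suc j) _ (s≤s z≤n) j<n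
        (sym (+-cancelʳ (q ^ suc n * elem n j) _ _
          (trans (elem-ratio n j) (trans (+-congʳ (sym e)) (+-comm _ _)))))

      -- The multiples of e_j agree for j = 0 because q^(n+1) = q, and for j > 0 because e_j is
      -- already zero.
      elem-middle : ∀ j → suc j < n → elem n (suc j) ≈ 0#
      elem-middle zero    j<n = elem-next zero j<n (*-congʳ (*-congˡ qⁿ≈1))
      elem-middle (suc j) j<n = elem-next (suc j) j<n
        (trans (trans (*-congˡ z) (zeroʳ _)) (sym (trans (*-congˡ z) (zeroʳ _))))
        where z = elem-middle j (ℕ.<-trans (ℕ.n<1+n _) j<n)

      elem-off-ends : ∀ j → 0 < j → j ≢ n → elem n j ≈ 0#
      elem-off-ends (suc j) _ j≢n with ℕ.<-cmp (suc j) n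
      ... | tri< j<n _ _ = elem-middle j j<n
      ... | tri≈ _ j≡n _ = ⊥-elim (j≢n j≡n)
      ... | tri> _ _ n<j = trans (*-congˡ (gauss-above n<j)) (zeroʳ _)

      -- With its middle coefficients gone, (1 + a q x)⋯(1 + a q^n x) is 1 + q^(n(n+1)/2) a^n x^n.
      steps-two-terms : ∀ a f h → steps n a f (h ℕ.+ n) ≈ f (h ℕ.+ n) + q ^ (suc n C 2) * a ^ n * f h
      steps-two-terms a f h = begin
        steps n a f (h ℕ.+ n)
          ≈⟨ steps-expand n a f (h ℕ.+ n) ⟩
        conv (λ j → elem n j * a ^ j) f (h ℕ.+ n)
          ≈⟨ conv-two-terms n _ f 0<n (solve 0 (con 1 :* con 1 :* con 1 := con 1) refl)
               (λ j 0<j j≢n → trans (*-congʳ (elem-off-ends j 0<j j≢n)) (zeroˡ _)) h ⟩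
        f (h ℕ.+ n) + q ^ (suc n C 2) * gauss n n * a ^ n * f h
          ≈⟨ +-congˡ (*-congʳ (*-congʳ (trans (*-congˡ (gauss-diag n)) (*-identityʳ _)))) ⟩
        f (h ℕ.+ n) + q ^ (suc n C 2) * a ^ n * f h ∎

      two-terms : ∀ h k → F (k ℕ.+ n) (h ℕ.+ n) + q ^ (suc n C 2) * (- q ^ k) ^ n * F (k ℕ.+ n) h
                        ≈ F k (h ℕ.+ n) + q ^ (suc n C 2) * (q ^ k) ^ n * F k h
      two-terms h k = trans (sym (steps-two-terms _ _ h))
        (trans (steps-telescope n k (h ℕ.+ n)) (steps-two-terms _ _ h))

      q^n*-≈1 : ∀ m → q ^ (n ℕ.* m) ≈ 1#
      q^n*-≈1 m = trans (sym (^-assocʳ q n m)) (trans (^-congˡ m qⁿ≈1) (1^n≈1 m))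

      q^-^n≈1 : ∀ k → (q ^ k) ^ n ≈ 1#
      q^-^n≈1 k = trans (^-assocʳ q k n) (trans (reflexive (≡.cong (q ^_) (ℕ.*-comm k n))) (q^n*-≈1 k))

      -- Here n divides n(n+1)/2, so q^(n(n+1)/2) = 1; the only sign comes from (-1)^n on the left
      -- of `two-terms`.
      odd-case : ∀ m → n ≡ suc (m ℕ.* 2) → ∀ h k →
        F (k ℕ.+ n) (h ℕ.+ n) ≈ F k (h ℕ.+ n) + F (k ℕ.+ n) h + F k h
      odd-case m n≡ h k = trans (x-y≈z⇒x≈z+y (begin
        F (k ℕ.+ n) (h ℕ.+ n) + - F (k ℕ.+ n) h
          ≈⟨ +-congˡ (trans (*-congʳ (trans (*-cong t≈1 neg) (*-identityˡ _))) (-1*x≈-x _)) ⟨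
        F (k ℕ.+ n) (h ℕ.+ n) + q ^ (suc n C 2) * (- q ^ k) ^ n * F (k ℕ.+ n) h
          ≈⟨ two-terms h k ⟩
        F k (h ℕ.+ n) + q ^ (suc n C 2) * (q ^ k) ^ n * F k h
          ≈⟨ +-congˡ (trans (*-congʳ (trans (*-cong t≈1 (q^-^n≈1 k)) (*-identityˡ _))) (*-identityˡ _)) ⟩
        F k (h ℕ.+ n) + F k h ∎))
        (solve 3 (λ a b c → a :+ b :+ c := a :+ c :+ b) refl _ _ _)
        where
        t≈1 : q ^ (suc n C 2) ≈ 1#
        t≈1 = trans (reflexive (≡.cong (q ^_) tri)) (q^n*-≈1 (suc m))
          where
          tri : suc n C 2 ≡ n ℕ.* suc m
          tri rewrite n≡ = ≡.trans (triangle-suc (m ℕ.* 2))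
            (≡.trans (≡.cong (suc (m ℕ.* 2) ℕ.+_) (triangle-even m)) (lemma m))
            where
            lemma : ∀ m → suc (m ℕ.* 2) ℕ.+ (m ℕ.* 2 ℕ.* m ℕ.+ m) ≡ suc (m ℕ.* 2) ℕ.* suc m
            lemma = ℕ-Solver.solve-∀
        neg : (- q ^ k) ^ n ≈ - 1#
        neg = begin
          (- q ^ k) ^ n  ≡⟨ ≡.cong ((- q ^ k) ^_) n≡ ⟩
          (- q ^ k) ^ suc (m ℕ.* 2)  ≈⟨ -‿^-odd _ m ⟩
          - ((q ^ k) ^ suc (m ℕ.* 2))  ≡⟨ ≡.cong (λ i → - ((q ^ k) ^ i)) n≡ ⟨
          - ((q ^ k) ^ n)  ≈⟨ -‿cong (q^-^n≈1 k) ⟩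
          - 1# ∎

      -- Here (-1)^n = 1, and the sign is q^(n(n+1)/2) = q^(n/2) = -1, which occurs on both sides of
      -- `two-terms`.
      even-case : ∀ m → n ≡ m ℕ.* 2 → ∀ h k →
        F (k ℕ.+ n) (h ℕ.+ n) ≈ F k (h ℕ.+ n) + F (k ℕ.+ n) h - F k h
      even-case m n≡ h k = trans (x-y≈z⇒x≈z+y (begin
        F (k ℕ.+ n) (h ℕ.+ n) + - F (k ℕ.+ n) h
          ≈⟨ +-congˡ (trans (*-congʳ (trans (*-cong t≈-1 even) (*-identityʳ _))) (-1*x≈-x _)) ⟨
        F (k ℕ.+ n) (h ℕ.+ n) + q ^ (suc n C 2) * (- q ^ k) ^ n * F (k ℕ.+ n) h
          ≈⟨ two-terms h k ⟩
        F k (h ℕ.+ n) + q ^ (suc n C 2) * (q ^ k) ^ n * F k h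
          ≈⟨ +-congˡ (trans (*-congʳ (trans (*-cong t≈-1 (q^-^n≈1 k)) (*-identityʳ _))) (-1*x≈-x _)) ⟩
        F k (h ℕ.+ n) + - F k h ∎))
        (solve 3 (λ a b c → a :+ b :+ c := a :+ c :+ b) refl _ _ _)
        where
        0<m : 0 < m
        0<m = ℕ.n≢0⇒n>0 (λ { ≡.refl → ℕ.<⇒≢ 0<n (≡.sym n≡) })
        m<n : m < n
        m<n = ≡.subst (m <_) (≡.sym n≡) (ℕ.m<m*n m 2 {{ℕ.>-nonZero 0<m}} ℕ.≤-refl)
        -- 1 + q^m is fixed by q^m, because q^(2m) ≈ 1.
        q^m≈-1 : q ^ m ≈ - 1#
        q^m≈-1 = +-inverseʳ-unique 1# (q ^ m) (fixed⇒0 m _ 0<m m<n (begin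
          q ^ m * (1# + q ^ m)
            ≈⟨ solve 1 (λ y → y :* (con 1 :+ y) := y :* y :+ y) refl (q ^ m) ⟩
          q ^ m * q ^ m + q ^ m
            ≈⟨ +-congʳ (trans (sym (^-homo-* q m m)) (trans (reflexive (≡.cong (q ^_) double)) qⁿ≈1)) ⟩
          1# + q ^ m ∎))
          where
          double : m ℕ.+ m ≡ n
          double = ≡.trans (≡.trans (≡.cong (m ℕ.+_) (≡.sym (ℕ.+-identityʳ m))) (ℕ.*-comm 2 m)) (≡.sym n≡)
        t≈-1 : q ^ (suc n C 2) ≈ - 1#
        t≈-1 = begin
          q ^ (suc n C 2)  ≡⟨ ≡.cong (q ^_) tri ⟩
          q ^ (n ℕ.* m ℕ.+ m)  ≈⟨ ^-homo-* q (n ℕ.* m) m ⟩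
          q ^ (n ℕ.* m) * q ^ m  ≈⟨ *-cong (q^n*-≈1 m) q^m≈-1 ⟩
          1# * - 1#  ≈⟨ *-identityˡ _ ⟩
          - 1# ∎
          where
          tri : suc n C 2 ≡ n ℕ.* m ℕ.+ m
          tri rewrite n≡ = triangle-even m
        even : (- q ^ k) ^ n ≈ 1#
        even = begin
          (- q ^ k) ^ n  ≡⟨ ≡.cong ((- q ^ k) ^_) n≡ ⟩
          (- q ^ k) ^ (m ℕ.* 2)  ≈⟨ -‿^-even _ m ⟩
          (q ^ k) ^ (m ℕ.* 2)  ≡⟨ ≡.cong ((q ^ k) ^_) n≡ ⟨
          (q ^ k) ^ n  ≈⟨ q^-^n≈1 k ⟩
          1# ∎

-- The ring ℤ[q]

coeff : Poly → ℕ → ℤ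
coeff []      i       = + 0
coeff (a ∷ p) zero    = a
coeff (a ∷ p) (suc i) = coeff p i

infix 4 _≈_
-- Lists that differ in trailing zeros denote the same polynomial, hence equality by coefficients.
-- The record, unlike a bare function type, lets p and r be inferred.
record _≈_ (p r : Poly) : Set where
  constructor mk≈
  field at : ∀ i → coeff p i ≡ coeff r i
open _≈_

≈-refl : ∀ {p} → p ≈ p
≈-refl .at i = ≡.refl

≈-sym : ∀ {p r} → p ≈ r → r ≈ p
≈-sym e .at i = ≡.sym (at e i)

≈-trans : ∀ {p r s} → p ≈ r → r ≈ s → p ≈ s
≈-trans e f .at i = ≡.trans (at e i) (at f i)

∷-cong : ∀ {a b p r} → a ≡ b → p ≈ r → a ∷ p ≈ b ∷ r
∷-cong e f .at zero    = e
∷-cong e f .at (suc i) = at f i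

0∷[]≈0 : + 0 ∷ [] ≈ []
0∷[]≈0 .at zero    = ≡.refl
0∷[]≈0 .at (suc i) = ≡.refl

coeff-+ : ∀ p r i → coeff (p +ₚ r) i ≡ coeff p i ℤ.+ coeff r i
coeff-+ []      r       i       = ≡.sym (ℤ.+-identityˡ _)
coeff-+ (a ∷ p) []      i       = ≡.sym (ℤ.+-identityʳ _)
coeff-+ (a ∷ p) (b ∷ r) zero    = ≡.refl
coeff-+ (a ∷ p) (b ∷ r) (suc i) = coeff-+ p r i

coeff-neg : ∀ p i → coeff (-ₚ p) i ≡ ℤ.- coeff p i
coeff-neg []      i       = ≡.refl
coeff-neg (a ∷ p) zero    = ≡.refl
coeff-neg (a ∷ p) (suc i) = coeff-neg p i

coeff-· : ∀ c p i → coeff (c ·ₚ p) i ≡ c ℤ.* coeff p i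
coeff-· c []      i       = ≡.sym (ℤ.*-zeroʳ c)
coeff-· c (a ∷ p) zero    = ≡.refl
coeff-· c (a ∷ p) (suc i) = coeff-· c p i

+-cong : ∀ {p p′ r r′} → p ≈ p′ → r ≈ r′ → p +ₚ r ≈ p′ +ₚ r′
+-cong {p} {p′} {r} {r′} e f .at i = ≡.trans (coeff-+ p r i)
  (≡.trans (≡.cong₂ ℤ._+_ (at e i) (at f i)) (≡.sym (coeff-+ p′ r′ i)))

+-assoc : ∀ p r s → (p +ₚ r) +ₚ s ≈ p +ₚ (r +ₚ s)
+-assoc p r s .at i
  rewrite coeff-+ (p +ₚ r) s i | coeff-+ p r i | coeff-+ p (r +ₚ s) i | coeff-+ r s i = ℤ.+-assoc (coeff p i) _ _

+-comm : ∀ p r → p +ₚ r ≈ r +ₚ p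
+-comm p r .at i rewrite coeff-+ p r i | coeff-+ r p i = ℤ.+-comm (coeff p i) _

+-identityʳ : ∀ p → p +ₚ [] ≈ p
+-identityʳ p = +-comm p []

neg-cong : ∀ {p r} → p ≈ r → -ₚ p ≈ -ₚ r
neg-cong {p} {r} e .at i rewrite coeff-neg p i | coeff-neg r i = ≡.cong ℤ.-_ (at e i)

+-inverseˡ : ∀ p → (-ₚ p) +ₚ p ≈ []
+-inverseˡ p .at i rewrite coeff-+ (-ₚ p) p i | coeff-neg p i = ℤ.+-inverseˡ (coeff p i)

·-cong : ∀ c {p r} → p ≈ r → c ·ₚ p ≈ c ·ₚ r
·-cong c {p} {r} e .at i rewrite coeff-· c p i | coeff-· c r i = ≡.cong (c ℤ.*_) (at e i)

·-distribˡ : ∀ c p r → c ·ₚ (p +ₚ r) ≈ c ·ₚ p +ₚ c ·ₚ r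
·-distribˡ c p r .at i
  rewrite coeff-· c (p +ₚ r) i | coeff-+ p r i | coeff-+ (c ·ₚ p) (c ·ₚ r) i | coeff-· c p i | coeff-· c r i
  = ℤ.*-distribˡ-+ c (coeff p i) (coeff r i)

·-assoc : ∀ c d p → (c ℤ.* d) ·ₚ p ≈ c ·ₚ (d ·ₚ p)
·-assoc c d p .at i rewrite coeff-· (c ℤ.* d) p i | coeff-· c (d ·ₚ p) i | coeff-· d p i = ℤ.*-assoc c d (coeff p i)

·-zeroˡ : ∀ p → + 0 ·ₚ p ≈ []
·-zeroˡ p .at i = coeff-· (+ 0) p i

·-identityˡ : ∀ p → + 1 ·ₚ p ≈ p
·-identityˡ p .at i = ≡.trans (coeff-· (+ 1) p i) (ℤ.*-identityˡ _)

+-interchange : ∀ p r s t → (p +ₚ r) +ₚ (s +ₚ t) ≈ (p +ₚ s) +ₚ (r +ₚ t)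
+-interchange p r s t .at i
  rewrite coeff-+ (p +ₚ r) (s +ₚ t) i | coeff-+ p r i | coeff-+ s t i
        | coeff-+ (p +ₚ s) (r +ₚ t) i | coeff-+ p s i | coeff-+ r t i
  = lemma (coeff p i) (coeff r i) (coeff s i) (coeff t i)
  where
  lemma : ∀ a b c d → (a ℤ.+ b) ℤ.+ (c ℤ.+ d) ≡ (a ℤ.+ c) ℤ.+ (b ℤ.+ d)
  lemma = ℤ-Solver.solve-∀

+-swap : ∀ p r s → p +ₚ (r +ₚ s) ≈ r +ₚ (p +ₚ s)
+-swap p r s = ≈-trans (≈-sym (+-assoc p r s)) (≈-trans (+-cong (+-comm p r) ≈-refl) (+-assoc r p s))

*-zeroʳ : ∀ p → p *ₚ [] ≈ []
*-zeroʳ []      = ≈-refl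
*-zeroʳ (a ∷ p) = ≈-trans (∷-cong ≡.refl (*-zeroʳ p)) 0∷[]≈0

*-congˡ : ∀ p {r s} → r ≈ s → p *ₚ r ≈ p *ₚ s
*-congˡ []      e = ≈-refl
*-congˡ (a ∷ p) e = +-cong (·-cong a e) (∷-cong ≡.refl (*-congˡ p e))

-- Expansion along the second factor, the mirror image of the recursion of `_*ₚ_`; commutativity
-- rests on it.
*-∷ : ∀ p b r → p *ₚ (b ∷ r) ≈ (b ·ₚ p) +ₚ (+ 0 ∷ p *ₚ r)
*-∷ []      b r = ≈-sym 0∷[]≈0
*-∷ (a ∷ p) b r = ∷-cong (≡.cong (ℤ._+ + 0) (ℤ.*-comm a b))
  (≈-trans (+-cong ≈-refl (*-∷ p b r)) (+-swap (a ·ₚ r) (b ·ₚ p) _))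

*-comm : ∀ p r → p *ₚ r ≈ r *ₚ p
*-comm []      r = ≈-sym (*-zeroʳ r)
*-comm (a ∷ p) r = ≈-trans (+-cong ≈-refl (∷-cong ≡.refl (*-comm p r))) (≈-sym (*-∷ r a p))

*-cong : ∀ {p p′ r r′} → p ≈ p′ → r ≈ r′ → p *ₚ r ≈ p′ *ₚ r′
*-cong {p} {p′} {r} {r′} e f =
  ≈-trans (*-congˡ p f) (≈-trans (*-comm p r′) (≈-trans (*-congˡ r′ e) (*-comm r′ p′)))

*-distribˡ : ∀ p r s → p *ₚ (r +ₚ s) ≈ p *ₚ r +ₚ p *ₚ s
*-distribˡ []      r s = ≈-refl
*-distribˡ (a ∷ p) r s = ≈-trans (+-cong (·-distribˡ a r s) (∷-cong ≡.refl (*-distribˡ p r s)))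
  (+-interchange (a ·ₚ r) (a ·ₚ s) (+ 0 ∷ p *ₚ r) (+ 0 ∷ p *ₚ s))

*-distribʳ : ∀ p r s → (r +ₚ s) *ₚ p ≈ r *ₚ p +ₚ s *ₚ p
*-distribʳ p r s = ≈-trans (*-comm (r +ₚ s) p) (≈-trans (*-distribˡ p r s) (+-cong (*-comm p r) (*-comm p s)))

0∷-* : ∀ p r → (+ 0 ∷ p) *ₚ r ≈ + 0 ∷ p *ₚ r
0∷-* p r = +-cong (·-zeroˡ r) ≈-refl

·-* : ∀ c p r → (c ·ₚ p) *ₚ r ≈ c ·ₚ (p *ₚ r)
·-* c []      r = ≈-refl
·-* c (a ∷ p) r = ≈-trans (+-cong (·-assoc c a r) (∷-cong (≡.sym (ℤ.*-zeroʳ c)) (·-* c p r)))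
  (≈-sym (·-distribˡ c (a ·ₚ r) (+ 0 ∷ p *ₚ r)))

*-assoc : ∀ p r s → (p *ₚ r) *ₚ s ≈ p *ₚ (r *ₚ s)
*-assoc []      r s = ≈-refl
*-assoc (a ∷ p) r s = ≈-trans (*-distribʳ s (a ·ₚ r) (+ 0 ∷ p *ₚ r))
  (+-cong (·-* a r s) (≈-trans (0∷-* (p *ₚ r) s) (∷-cong ≡.refl (*-assoc p r s))))

*-identityˡ : ∀ p → 1ₚ *ₚ p ≈ p
*-identityˡ p = ≈-trans (+-cong (·-identityˡ p) 0∷[]≈0) (+-identityʳ p)

≈-isEquivalence : IsEquivalence _≈_
≈-isEquivalence = record { refl = ≈-refl ; sym = ≈-sym ; trans = ≈-trans }

polyIsCommutativeRing : IsCommutativeRing _≈_ _+ₚ_ _*ₚ_ -ₚ_ 0ₚ 1ₚ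
polyIsCommutativeRing = record
  { isRing = record
    { +-isAbelianGroup = record
      { isGroup = record
        { isMonoid = record
          { isSemigroup = record
            { isMagma = record { isEquivalence = ≈-isEquivalence ; ∙-cong = +-cong }
            ; assoc = +-assoc }
          ; identity = (λ _ → ≈-refl) , +-identityʳ }
        ; inverse = +-inverseˡ , λ p → ≈-trans (+-comm p _) (+-inverseˡ p)
        ; ⁻¹-cong = neg-cong }
      ; comm = +-comm }
    ; *-cong = *-cong
    ; *-assoc = *-assoc
    ; *-identity = *-identityˡ , λ p → ≈-trans (*-comm p 1ₚ) (*-identityˡ p)
    ; distrib = *-distribˡ , *-distribʳ }
  ; *-comm = *-comm }

polyRing : CommutativeRing 0ℓ 0ℓ
polyRing = record { isCommutativeRing = polyIsCommutativeRing }

≈0⇒IsZero : ∀ p → p ≈ 0ₚ → IsZero p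
≈0⇒IsZero []      e = []
≈0⇒IsZero (a ∷ p) e = at e 0 ∷ ≈0⇒IsZero p (mk≈ (λ i → at e (suc i)))

open CommutativeRing polyRing using (setoid; reflexive)
open Relation.Binary.Reasoning.Setoid setoid

-- A partial zero test with which the ring solver discards vanishing constants.
0≈? : ∀ p → Maybe (0ₚ ≈ p)
0≈? [] = just ≈-refl
0≈? (+ 0 ∷ p) with 0≈? p
... | just e  = just (≈-trans (≈-sym 0∷[]≈0) (∷-cong ≡.refl e))
... | nothing = nothing
0≈? (_ ∷ p) = nothing

polyACR : AlmostCommutativeRing 0ℓ 0ℓ
polyACR = fromCommutativeRing polyRing 0≈?

-- Monic polynomials

+1≢+0 : + 1 ≢ + 0
+1≢+0 ()

-- The degree is stated through coefficients, since trailing zeros make list length unreliable.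
record Monic (d : ℕ) (p : Poly) : Set where
  field
    lead  : coeff p d ≡ + 1
    above : ∀ i → d < i → coeff p i ≡ + 0
open Monic

Monic-resp : ∀ {d p r} → p ≈ r → Monic d p → Monic d r
Monic-resp e M .lead      = ≡.trans (≡.sym (at e _)) (lead M)
Monic-resp e M .above i l = ≡.trans (≡.sym (at e i)) (above M i l)

coeff-*-∷ : ∀ p b r i → coeff (p *ₚ (b ∷ r)) i ≡ b ℤ.* coeff p i ℤ.+ coeff (+ 0 ∷ p *ₚ r) i
coeff-*-∷ p b r i = ≡.trans (at (*-∷ p b r) i)
  (≡.trans (coeff-+ (b ·ₚ p) _ i) (≡.cong (ℤ._+ _) (coeff-· b p i)))

-- Beyond degree d the summand b · p vanishes and only the shift remains. This drives the inductions
-- on the second factor below.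
coeff-*-∷-above : ∀ {d p} → Monic d p → ∀ b r i → d ≤ i → coeff (p *ₚ (b ∷ r)) (suc i) ≡ coeff (p *ₚ r) i
coeff-*-∷-above {d} {p} M b r i d≤i = ≡.trans (coeff-*-∷ p b r (suc i))
  (≡.trans (≡.cong (λ x → b ℤ.* x ℤ.+ coeff (p *ₚ r) i) (above M (suc i) (s≤s d≤i)))
  (≡.trans (≡.cong (ℤ._+ coeff (p *ₚ r) i) (ℤ.*-zeroʳ b)) (ℤ.+-identityˡ _)))

coeff-*-∷-lead : ∀ {d p} → Monic d p → ∀ b r → coeff (p *ₚ (b ∷ r)) d ≡ b ℤ.+ coeff (+ 0 ∷ p *ₚ r) d
coeff-*-∷-lead {d} {p} M b r = ≡.trans (coeff-*-∷ p b r d)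
  (≡.cong (ℤ._+ _) (≡.trans (≡.cong (b ℤ.*_) (lead M)) (ℤ.*-identityʳ b)))

Monic-* : ∀ {d e p r} → Monic d p → Monic e r → Monic (d ℕ.+ e) (p *ₚ r)
Monic-* {d} {e} {p} {[]}    M N with () ← lead N
Monic-* {d} {zero} {p} {b ∷ r} M N = Monic-resp p≈ (≡.subst (λ i → Monic i p) (≡.sym (ℕ.+-identityʳ d)) M)
  where
  p≈ : p ≈ p *ₚ (b ∷ r)
  p≈ = ≈-trans (≈-sym (*-identityˡ p)) (≈-trans (*-comm 1ₚ p)
    (*-congˡ p (∷-cong (≡.sym (lead N)) (mk≈ (λ i → ≡.sym (above N (suc i) (s≤s z≤n)))))))
Monic-* {d} {suc e} {p} {b ∷ r} M N = ≡.subst (λ i → Monic i (p *ₚ (b ∷ r))) (≡.sym (ℕ.+-suc d e))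
  record { lead = ≡.trans (coeff-*-∷-above M b r _ (ℕ.m≤m+n d e)) (lead IH)
         ; above = λ { (suc i) (s≤s l) → ≡.trans (coeff-*-∷-above M b r i (ℕ.≤-trans (ℕ.m≤m+n d e) (ℕ.<⇒≤ l))) (above IH i l) } }
  where
  IH : Monic (d ℕ.+ e) (p *ₚ r)
  IH = Monic-* M (record { lead = lead N ; above = λ i l → above N (suc i) (s≤s l) })

0∷-· : ∀ m p → + 0 ∷ m ·ₚ p ≈ m ·ₚ (+ 0 ∷ p)
0∷-· m p = ∷-cong (≡.sym (ℤ.*-zeroʳ m)) ≈-refl

*-· : ∀ m p r → p *ₚ (m ·ₚ r) ≈ m ·ₚ (p *ₚ r)
*-· m p r = ≈-trans (*-comm p _) (≈-trans (·-* m r p) (·-cong m (*-comm r p)))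

-- With m = 0 this is cancellation of monic factors, with m ≠ 0 it says that
-- quotients by monic polynomials have no m-torsion.
Monic-descent : ∀ {d p} → Monic d p → ∀ m r → (∀ i → d ≤ i → ∃[ k ] coeff (p *ₚ r) i ≡ m ℤ.* k) →
                ∃[ r′ ] r ≈ m ·ₚ r′
Monic-descent M m []      div = [] , ≈-refl
Monic-descent {d} {p} M m (b ∷ r) div
  -- Coefficients above d do not see b, so the tail is treated first; the coefficient at d is then b
  -- plus a multiple of m.
  with r′ , r≈ ← Monic-descent M m r
         (λ i l → proj₁ (div (suc i) (ℕ.m≤n⇒m≤1+n l))
                , ≡.trans (≡.sym (coeff-*-∷-above M b r i l)) (proj₂ (div (suc i) (ℕ.m≤n⇒m≤1+n l))))
  with k , e ← div d ℕ.≤-refl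
  = (k ℤ.- x ∷ r′) , ∷-cong b≡ r≈
  where
  x : ℤ
  x = coeff (+ 0 ∷ p *ₚ r′) d
  tail≈ : + 0 ∷ p *ₚ r ≈ m ·ₚ (+ 0 ∷ p *ₚ r′)
  tail≈ = ≈-trans (∷-cong ≡.refl (≈-trans (*-congˡ p r≈) (*-· m p r′))) (0∷-· m (p *ₚ r′))
  lemma : ∀ b y → b ≡ (b ℤ.+ y) ℤ.- y
  lemma = ℤ-Solver.solve-∀
  lemma′ : ∀ m k x → m ℤ.* k ℤ.- m ℤ.* x ≡ m ℤ.* (k ℤ.- x)
  lemma′ = ℤ-Solver.solve-∀
  b≡ : b ≡ m ℤ.* (k ℤ.- x)
  b≡ = ≡.trans (lemma b (m ℤ.* x))
    (≡.trans (≡.cong (ℤ._- m ℤ.* x)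
      (≡.trans (≡.cong (λ y → b ℤ.+ y) (≡.sym (≡.trans (at tail≈ d) (coeff-· m (+ 0 ∷ p *ₚ r′) d))))
        (≡.trans (≡.sym (coeff-*-∷-lead M b r)) e)))
      (lemma′ m k x))

Monic-low⇒0 : ∀ {d p} → Monic d p → ∀ r → (∀ i → d ≤ i → coeff (p *ₚ r) i ≡ + 0) → r ≈ 0ₚ
Monic-low⇒0 M r z with r′ , e ← Monic-descent M (+ 0) r (λ i l → + 0 , z i l) = ≈-trans e (·-zeroˡ r′)

difference⇒≈ : ∀ {r s} → r -ₚ s ≈ 0ₚ → r ≈ s
difference⇒≈ {r} {s} e = ≈-trans (lemma r s) (+-cong e ≈-refl)
  where
  lemma : ∀ r s → r ≈ (r -ₚ s) +ₚ s
  lemma = solve-∀ polyACR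

Monic-cancel : ∀ {d p} → Monic d p → ∀ r s → p *ₚ r ≈ p *ₚ s → r ≈ s
Monic-cancel {d} {p} M r s e = difference⇒≈ (Monic-low⇒0 M (r -ₚ s) (λ i _ → at z i))
  where
  expand : ∀ p r s → p *ₚ (r -ₚ s) ≈ p *ₚ r -ₚ p *ₚ s
  expand = solve-∀ polyACR
  cancel : ∀ s → s -ₚ s ≈ []
  cancel = solve-∀ polyACR
  z : p *ₚ (r -ₚ s) ≈ []
  z = ≈-trans (expand p r s) (≈-trans (+-cong e ≈-refl) (cancel (p *ₚ s)))

·-cancel : ∀ m → m ≢ + 0 → ∀ p r → m ·ₚ p ≈ m ·ₚ r → p ≈ r
·-cancel m m≢0 p r e .at i = ℤ.*-cancelˡ-≡ m (coeff p i) (coeff r i) {{ℤ.≢-nonZero m≢0}}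
  (≡.trans (≡.sym (coeff-· m p i)) (≡.trans (at e i) (coeff-· m r i)))

-- Every coefficient of p s is a multiple of m, so s = m s′ by `Monic-descent`, and m cancels
-- coefficientwise.
Monic-torsion-free : ∀ {d p} → Monic d p → ∀ m → m ≢ + 0 → ∀ r s → m ·ₚ r ≈ p *ₚ s → ∃[ s′ ] r ≈ p *ₚ s′
Monic-torsion-free {d} {p} M m m≢0 r s e
  with s′ , s≈ ← Monic-descent M m s (λ i _ → coeff r i , ≡.trans (≡.sym (at e i)) (coeff-· m r i))
  = s′ , ·-cancel m m≢0 r (p *ₚ s′) (≈-trans e (≈-trans (*-congˡ p s≈) (*-· m p s′)))

-- Hands monicity on to quotients, in particular from q^n - 1 to Φ_n.
Monic-cofactor : ∀ {d p} → Monic d p → ∀ e r → Monic (d ℕ.+ e) (p *ₚ r) → Monic e r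
Monic-cofactor {d} {p} M e [] N with () ← ≡.trans (≡.sym (lead N)) (at (*-zeroʳ p) (d ℕ.+ e))
Monic-cofactor {d} {p} M zero (b ∷ r) N = record { lead = b≡1 ; above = λ { (suc i) _ → at r≈0 i } }
  where
  N′ : Monic d (p *ₚ (b ∷ r))
  N′ = ≡.subst (λ i → Monic i (p *ₚ (b ∷ r))) (ℕ.+-identityʳ d) N
  r≈0 : r ≈ 0ₚ
  r≈0 = Monic-low⇒0 M r (λ i l → ≡.trans (≡.sym (coeff-*-∷-above M b r i l)) (above N′ (suc i) (s≤s l)))
  b≡1 : b ≡ + 1
  b≡1 = ≡.trans (≡.sym (ℤ.+-identityʳ b)) (≡.trans
    (≡.cong (λ y → b ℤ.+ y) (≡.sym (at (≈-trans (∷-cong ≡.refl (≈-trans (*-congˡ p r≈0) (*-zeroʳ p))) 0∷[]≈0) d)))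
    (≡.trans (≡.sym (coeff-*-∷-lead M b r)) (lead N′)))
Monic-cofactor {d} {p} M (suc e) (b ∷ r) N = record { lead = lead IH ; above = λ { (suc i) (s≤s l) → above IH i l } }
  where
  N′ : Monic (suc (d ℕ.+ e)) (p *ₚ (b ∷ r))
  N′ = ≡.subst (λ i → Monic i (p *ₚ (b ∷ r))) (ℕ.+-suc d e) N
  IH : Monic e r
  IH = Monic-cofactor M e r record
    { lead  = ≡.trans (≡.sym (coeff-*-∷-above M b r _ (ℕ.m≤m+n d e))) (lead N′)
    ; above = λ i l → ≡.trans (≡.sym (coeff-*-∷-above M b r i (ℕ.≤-trans (ℕ.m≤m+n d e) (ℕ.<⇒≤ l)))) (above N′ (suc i) (s≤s l)) }

-- Were c < d, the product would have no coefficient from d on, forcing r and hence the product to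
-- be zero. Needed to write n as d + (n ∸ d) before `Monic-cofactor` applies.
Monic-cofactor-degree : ∀ {d c p} r → Monic d p → Monic c (p *ₚ r) → d ≤ c
Monic-cofactor-degree {d} {c} {p} r M N with d ℕ.≤? c
... | yes d≤c = d≤c
... | no d≰c = ⊥-elim (+1≢+0 (≡.trans (≡.sym (lead N)) (at (≈-trans (*-congˡ p r≈0) (*-zeroʳ p)) c)))
  where
  r≈0 : r ≈ 0ₚ
  r≈0 = Monic-low⇒0 M r (λ i d≤i → above N i (ℕ.<-≤-trans (ℕ.≰⇒> d≰c) d≤i))

-- Big-endian lists as polynomials

coeff-beyond : ∀ p i → length p ≤ i → coeff p i ≡ + 0
coeff-beyond []      i       _       = ≡.refl
coeff-beyond (a ∷ p) (suc i) (s≤s l) = coeff-beyond p i l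

snoc-≈ : ∀ p a → p ++ [ a ] ≈ (a ∷ []) *ₚ qpow (length p) +ₚ p
snoc-≈ []      a = ∷-cong (≡.sym (≡.trans (ℤ.+-identityʳ _) (ℤ.*-identityʳ a))) ≈-refl
snoc-≈ (b ∷ p) a = ≈-trans (∷-cong (≡.sym (≡.trans (≡.cong (λ x → x ℤ.+ + 0 ℤ.+ b) (ℤ.*-zeroʳ a)) (ℤ.+-identityˡ b))) (snoc-≈ p a))
  (∷-cong ≡.refl (+-cong {r = p} (+-cong {p = a ·ₚ qpow (length p)} ≈-refl 0∷[]≈0) ≈-refl))

reverse-∷-≈ : ∀ a p → reverse (a ∷ p) ≈ (a ∷ []) *ₚ qpow (length p) +ₚ reverse p
reverse-∷-≈ a p = ≈-trans (reflexive (unfold-reverse a p))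
  (≈-trans (snoc-≈ (reverse p) a) (reflexive (≡.cong (λ l → (a ∷ []) *ₚ qpow l +ₚ reverse p) (length-reverse p))))

reverse-0∷ : ∀ p → reverse (+ 0 ∷ p) ≈ reverse p
reverse-0∷ p = ≈-trans (reverse-∷-≈ (+ 0) p)
  (+-cong (≈-trans (*-cong 0∷[]≈0 (≈-refl {qpow (length p)})) ≈-refl) ≈-refl)

coeff-qpow : ∀ n → coeff (qpow n) n ≡ + 1
coeff-qpow zero    = ≡.refl
coeff-qpow (suc n) = coeff-qpow n

coeff-reverse-∷ : ∀ a p → coeff (reverse (a ∷ p)) (length p) ≡ a
coeff-reverse-∷ a p = ≡.trans (at (reverse-∷-≈ a p) (length p))
  (≡.trans (coeff-+ ((a ∷ []) *ₚ qpow (length p)) (reverse p) (length p))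
  (≡.trans (≡.cong₂ ℤ._+_ top (coeff-beyond (reverse p) (length p) (ℕ.≤-reflexive (length-reverse p)))) (ℤ.+-identityʳ a)))
  where
  top : coeff ((a ∷ []) *ₚ qpow (length p)) (length p) ≡ a
  top = ≡.trans (at (≈-trans (+-cong {p = a ·ₚ qpow (length p)} ≈-refl 0∷[]≈0) (+-identityʳ _)) (length p))
    (≡.trans (coeff-· a (qpow (length p)) (length p))
    (≡.trans (≡.cong (a ℤ.*_) (coeff-qpow (length p))) (ℤ.*-identityʳ a)))

-- Long division

-- Defs keeps the functions behind quotₚ and Φ private, so they are named here
-- as solutions of the unification problem posed by the accompanying equation;
-- making reverse a variable keeps the term under it visible to the unifier.
mutual
  longDivision : ℕ → List ℤ → List ℤ → List ℤ
  longDivision = _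

  quotₚ-longDivision : ∀ p r → quotₚ p r ≡ reverse (longDivision (length p) (reverse p) (reverse r))
  quotₚ-longDivision p r with reverse {A = ℤ}
  ... | rev with length p | rev p | rev r
  ... | l | x | y = ≡.refl

-- The divisor is presented with its leading 1, where the removal of leading zeros stops; its degree
-- is then `length y`.
longDivision-stop : ∀ l x y → length x ≤ length y → longDivision l x (+ 1 ∷ y) ≡ []
longDivision-stop zero    x       y _ = ≡.refl
longDivision-stop (suc l) []      y _ = ≡.refl
longDivision-stop (suc l) (a ∷ x) y x≤y with suc (length y) ℕ.≤? suc (length x)
... | no _    = ≡.refl
... | yes y≤x = ⊥-elim (ℕ.<⇒≱ x≤y (ℕ.≤-pred y≤x))

mutual
  subtractMultiple : List ℤ → List ℤ → ℤ → List ℤ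
  subtractMultiple = _

  -- The leading 1 of the divisor cancels a, so only the tails x and y enter the next round.
  longDivision-step : ∀ l a x y → length y ≤ length x →
    longDivision (suc l) (a ∷ x) (+ 1 ∷ y) ≡ a ∷ longDivision l (subtractMultiple x y a) (+ 1 ∷ y)
  longDivision-step l a x y y≤x with suc (length y) ℕ.≤? suc (length x)
  ... | yes _  = ≡.refl
  ... | no y≰x = ⊥-elim (y≰x (s≤s y≤x))

length-subtractMultiple : ∀ x y c → length (subtractMultiple x y c) ≡ length x
length-subtractMultiple x       []      c = ≡.refl
length-subtractMultiple []      (b ∷ y) c = ≡.refl
length-subtractMultiple (a ∷ x) (b ∷ y) c = ≡.cong suc (length-subtractMultiple x y c)

0∷-≈ : ∀ p → + 0 ∷ p ≈ qpow 1 *ₚ p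
0∷-≈ p = ≈-sym (≈-trans (0∷-* 1ₚ p) (∷-cong ≡.refl (*-identityˡ p)))

qpow-+ : ∀ m n → qpow (m ℕ.+ n) ≈ qpow m *ₚ qpow n
qpow-+ zero    n = ≈-sym (*-identityˡ (qpow n))
qpow-+ (suc m) n = ≈-trans (∷-cong ≡.refl (qpow-+ m n)) (≈-sym (0∷-* (qpow m) (qpow n)))

-- Big-endian lists are aligned at the front, whence the shift by the difference of lengths.
reverse-subtractMultiple : ∀ x y c → length y ≤ length x →
  reverse (subtractMultiple x y c) ≈ reverse x -ₚ (c ∷ []) *ₚ (qpow (length x ∸ length y) *ₚ reverse y)
reverse-subtractMultiple x [] c _ = ≈-sym (begin
  reverse x -ₚ (c ∷ []) *ₚ (qpow (length x) *ₚ [])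
    ≈⟨ +-cong ≈-refl (neg-cong (≈-trans (*-congˡ (c ∷ []) (*-zeroʳ (qpow (length x)))) (*-zeroʳ (c ∷ [])))) ⟩
  reverse x +ₚ []
    ≈⟨ +-identityʳ _ ⟩
  reverse x ∎)
reverse-subtractMultiple (a ∷ x) (b ∷ y) c (s≤s y≤x) = begin
  reverse (a ℤ.- c ℤ.* b ∷ subtractMultiple x y c)
    ≈⟨ reverse-∷-≈ _ (subtractMultiple x y c) ⟩
  (a ℤ.- c ℤ.* b ∷ []) *ₚ qpow (length (subtractMultiple x y c)) +ₚ reverse (subtractMultiple x y c)
    ≈⟨ +-cong (*-cong constants (≈-trans (reflexive (≡.cong qpow (≡.trans (length-subtractMultiple x y c) (≡.sym (ℕ.m∸n+n≡m y≤x)))))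
                                         (qpow-+ (length x ∸ length y) (length y))))
              (reverse-subtractMultiple x y c y≤x) ⟩
  ((a ∷ []) -ₚ (c ∷ []) *ₚ (b ∷ [])) *ₚ (d *ₚ qpow (length y)) +ₚ (reverse x -ₚ (c ∷ []) *ₚ (d *ₚ reverse y))
    ≈⟨ rearrange (a ∷ []) (b ∷ []) (c ∷ []) d (qpow (length y)) (reverse x) (reverse y) ⟩
  ((a ∷ []) *ₚ (d *ₚ qpow (length y)) +ₚ reverse x) -ₚ (c ∷ []) *ₚ (d *ₚ ((b ∷ []) *ₚ qpow (length y) +ₚ reverse y))
    ≈⟨ +-cong (≈-trans (+-cong (*-congˡ (a ∷ []) (≈-trans (≈-sym (qpow-+ (length x ∸ length y) (length y)))
                                                    (reflexive (≡.cong qpow (ℕ.m∸n+n≡m y≤x))))) ≈-refl)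
                       (≈-sym (reverse-∷-≈ a x)))
              (neg-cong (*-congˡ (c ∷ []) (*-congˡ d (≈-sym (reverse-∷-≈ b y))))) ⟩
  reverse (a ∷ x) -ₚ (c ∷ []) *ₚ (d *ₚ reverse (b ∷ y)) ∎
  where
  d = qpow (length x ∸ length y)
  constants : a ℤ.- c ℤ.* b ∷ [] ≈ (a ∷ []) -ₚ (c ∷ []) *ₚ (b ∷ [])
  constants = ∷-cong (≡.cong (λ t → a ℤ.- t) (≡.sym (ℤ.+-identityʳ (c ℤ.* b)))) ≈-refl
  rearrange : ∀ a b c d e x y → (a -ₚ c *ₚ b) *ₚ (d *ₚ e) +ₚ (x -ₚ c *ₚ (d *ₚ y))
                              ≈ (a *ₚ (d *ₚ e) +ₚ x) -ₚ c *ₚ (d *ₚ (b *ₚ e +ₚ y))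
  rearrange = solve-∀ polyACR

-- `quotient-length` belongs to the invariant because it determines the power of q at which the next
-- leading coefficient of the quotient lands.
record Division (x y quotient : List ℤ) : Set where
  field
    remainder        : Poly
    remainder-low    : ∀ i → length y ≤ i → coeff remainder i ≡ + 0
    decomposition    : reverse x ≈ reverse (+ 1 ∷ y) *ₚ reverse quotient +ₚ remainder
    quotient-length  : length quotient ≡ length x ∸ length y
open Division

Division-step : ∀ a x y {Q} → length y ≤ length x → Division (subtractMultiple x y a) y Q → Division (a ∷ x) y (a ∷ Q)
Division-step a x y {Q} y≤x IH = record
  { remainder       = remainder IH
  ; remainder-low   = remainder-low IH
  ; decomposition   = begin
      reverse (a ∷ x)
        ≈⟨ reverse-∷-≈ a x ⟩
      (a ∷ []) *ₚ qpow (length x) +ₚ reverse x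
        ≈⟨ +-cong (*-congˡ (a ∷ []) (≈-trans (reflexive (≡.cong qpow (≡.sym (ℕ.m∸n+n≡m y≤x)))) (qpow-+ (length x ∸ length y) (length y))))
                  (restore (reverse x) ((a ∷ []) *ₚ (d *ₚ reverse y))) ⟩
      (a ∷ []) *ₚ (d *ₚ e) +ₚ ((reverse x -ₚ (a ∷ []) *ₚ (d *ₚ reverse y)) +ₚ (a ∷ []) *ₚ (d *ₚ reverse y))
        ≈⟨ +-cong {p = (a ∷ []) *ₚ (d *ₚ e)} ≈-refl (+-cong {r = (a ∷ []) *ₚ (d *ₚ reverse y)}
             (≈-trans (≈-sym (reverse-subtractMultiple x y a y≤x)) (decomposition IH)) ≈-refl) ⟩
      (a ∷ []) *ₚ (d *ₚ e) +ₚ ((B *ₚ reverse Q +ₚ remainder IH) +ₚ (a ∷ []) *ₚ (d *ₚ reverse y))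
        ≈⟨ rearrange (a ∷ []) d e (B *ₚ reverse Q) (remainder IH) (reverse y) ⟩
      ((1ₚ *ₚ e +ₚ reverse y) *ₚ ((a ∷ []) *ₚ d) +ₚ B *ₚ reverse Q) +ₚ remainder IH
        ≈⟨ +-cong {r = remainder IH} (+-cong {r = B *ₚ reverse Q}
             (*-cong {p′ = B} (≈-sym (reverse-∷-≈ (+ 1) y)) (*-congˡ (a ∷ []) (reflexive (≡.cong qpow (≡.sym |Q|))))) ≈-refl) ≈-refl ⟩
      (B *ₚ ((a ∷ []) *ₚ qpow (length Q)) +ₚ B *ₚ reverse Q) +ₚ remainder IH
        ≈⟨ +-cong {r = remainder IH} (≈-trans (≈-sym (*-distribˡ B ((a ∷ []) *ₚ qpow (length Q)) (reverse Q)))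
             (*-congˡ B (≈-sym (reverse-∷-≈ a Q)))) ≈-refl ⟩
      B *ₚ reverse (a ∷ Q) +ₚ remainder IH ∎
  ; quotient-length = ≡.trans (≡.cong suc |Q|) (≡.sym (ℕ.+-∸-assoc 1 y≤x)) }
  where
  |Q| : length Q ≡ length x ∸ length y
  |Q| = ≡.trans (quotient-length IH) (≡.cong (_∸ length y) (length-subtractMultiple x y a))
  B = reverse (+ 1 ∷ y)
  d = qpow (length x ∸ length y)
  e = qpow (length y)
  restore : ∀ u v → u ≈ (u -ₚ v) +ₚ v
  restore = solve-∀ polyACR
  rearrange : ∀ a d e b r y → a *ₚ (d *ₚ e) +ₚ ((b +ₚ r) +ₚ a *ₚ (d *ₚ y))
                            ≈ ((1ₚ *ₚ e +ₚ y) *ₚ (a *ₚ d) +ₚ b) +ₚ r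
  rearrange = solve-∀ polyACR

-- The fuel suffices because each round shortens the dividend by one entry.
longDivision-correct : ∀ l x y → length x ≡ l → Division x y (longDivision l x (+ 1 ∷ y))
longDivision-correct l x y |x|≡l with length y ℕ.<? length x
longDivision-correct l x y |x|≡l | no y≮x rewrite longDivision-stop l x y (ℕ.≮⇒≥ y≮x) = record
  { remainder       = reverse x
  ; remainder-low   = λ i y≤i → coeff-beyond (reverse x) i
                        (≡.subst (_≤ i) (≡.sym (length-reverse x)) (ℕ.≤-trans (ℕ.≮⇒≥ y≮x) y≤i))
  ; decomposition   = ≈-sym (+-cong (*-zeroʳ (reverse (+ 1 ∷ y))) ≈-refl)
  ; quotient-length = ≡.sym (ℕ.m≤n⇒m∸n≡0 (ℕ.≮⇒≥ y≮x)) }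
longDivision-correct (suc l) (a ∷ x) y |x|≡l | yes (s≤s y≤x) =
  ≡.subst (Division (a ∷ x) y) (≡.sym (longDivision-step l a x y y≤x))
    (Division-step a x y y≤x (longDivision-correct l (subtractMultiple x y a) y
      (≡.trans (length-subtractMultiple x y a) (ℕ.suc-injective |x|≡l))))

length-Monic : ∀ {d} a x → Monic d (reverse (a ∷ x)) → a ≢ + 0 → length x ≡ d
length-Monic {d} a x M a≢0 with ℕ.<-cmp (length x) d
... | tri≈ _ e _ = e
... | tri> _ _ d<x = ⊥-elim (a≢0 (≡.trans (≡.sym (coeff-reverse-∷ a x)) (above M (length x) d<x)))
... | tri< x<d _ _ = ⊥-elim (+1≢+0 (≡.trans (≡.sym (lead M)) (coeff-beyond (reverse (a ∷ x)) d
                       (≡.subst (_≤ d) (≡.sym (length-reverse (a ∷ x))) x<d))))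

-- Long division discards the leading zeros of the (reversed) divisor y.
longDivision-Monic : ∀ {d} y → Monic d (reverse y) →
  ∃[ y′ ] length y′ ≡ d × reverse (+ 1 ∷ y′) ≈ reverse y × (∀ l x → longDivision l x y ≡ longDivision l x (+ 1 ∷ y′))
longDivision-Monic [] M with () ← lead M
longDivision-Monic {d} (a ∷ y) M with a ℤ.≟ + 0
... | yes ≡.refl with y′ , l , e , f ← longDivision-Monic y (Monic-resp (reverse-0∷ y) M)
    = y′ , l , ≈-trans e (≈-sym (reverse-0∷ y)) , λ l x → f l x
... | no a≢0 with ≡.refl ← length-Monic a y M a≢0
             with ≡.refl ← ≡.trans (≡.sym (coeff-reverse-∷ a y)) (lead M)
    = y , ≡.refl , ≈-refl , λ _ _ → ≡.refl

-- For the computed quotient Q, the product r (s - Q) equals the remainder, which has no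
-- coefficients from the degree of r on; so s - Q vanishes.
quotₚ-exact : ∀ {d p r} s → Monic d r → p ≈ r *ₚ s → quotₚ p r ≈ s
quotₚ-exact {d} {p} {r} s M p≈
  with y′ , ≡.refl , y′≈ , f ← longDivision-Monic (reverse r) (≡.subst (Monic d) (≡.sym (reverse-involutive r)) M)
  = ≈-trans (reflexive (≡.trans (quotₚ-longDivision p r) (≡.cong reverse (f (length p) (reverse p)))))
            (≈-sym (difference⇒≈ (Monic-low⇒0 M (s -ₚ Q) (λ i d≤i → ≡.trans (at remainder≈ i) (remainder-low div i d≤i)))))
  where
  div : Division (reverse p) y′ (longDivision (length p) (reverse p) (+ 1 ∷ y′))
  div = longDivision-correct (length p) (reverse p) y′ (length-reverse p)
  Q : Poly
  Q = reverse (longDivision (length p) (reverse p) (+ 1 ∷ y′))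
  r≈ : reverse (+ 1 ∷ y′) ≈ r
  r≈ = ≈-trans y′≈ (reflexive (reverse-involutive r))
  expand : ∀ r s Q → r *ₚ (s -ₚ Q) ≈ r *ₚ s -ₚ r *ₚ Q
  expand = solve-∀ polyACR
  cancel : ∀ u v → (u +ₚ v) -ₚ u ≈ v
  cancel = solve-∀ polyACR
  remainder≈ : r *ₚ (s -ₚ Q) ≈ remainder div
  remainder≈ = begin
    r *ₚ (s -ₚ Q)  ≈⟨ expand r s Q ⟩
    r *ₚ s -ₚ r *ₚ Q  ≈⟨ +-cong (≈-sym p≈) ≈-refl ⟩
    p -ₚ r *ₚ Q  ≈⟨ +-cong (≈-trans (reflexive (≡.sym (reverse-involutive p))) (≈-trans (decomposition div) (+-cong (*-cong r≈ (≈-refl {Q})) ≈-refl))) ≈-refl ⟩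
    (r *ₚ Q +ₚ remainder div) -ₚ r *ₚ Q  ≈⟨ cancel (r *ₚ Q) (remainder div) ⟩
    remainder div ∎

-- The q-Delannoy numbers

open Algebra.Properties.CommutativeSemiring.Exp (CommutativeRing.commutativeSemiring polyRing) using (_^_)
open Sequences polyRing using (sum≤; step)
open GaussianBinomials polyRing (qpow 1) using (gauss; elem; complete; delannoy; delannoy-step)

qpow-^ : ∀ n → qpow n ≈ qpow 1 ^ n
qpow-^ zero    = ≈-refl
qpow-^ (suc n) = ≈-trans (0∷-≈ (qpow n)) (*-congˡ (qpow 1) (qpow-^ n))

qint-+ : ∀ m n → qint (m ℕ.+ n) ≈ qint m +ₚ qpow m *ₚ qint n
qint-+ zero    n = ≈-sym (*-identityˡ (qint n))
qint-+ (suc m) n = ≈-trans (∷-cong ≡.refl (qint-+ m n))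
  (+-cong {p = + 1 ∷ qint m} ≈-refl (≈-sym (0∷-* (qpow m) (qint n))))

-- Splits off the largest factor, where the definition splits off the smallest.
fallingQ-suc : ∀ h k → fallingQ (suc h) (suc k) ≈ qint (suc h) *ₚ fallingQ h k
fallingQ-suc h zero    = ≈-refl
fallingQ-suc h (suc k) = ≈-trans (*-congˡ (qint (h ∸ k)) (fallingQ-suc h k)) (swap (qint (h ∸ k)) (qint (suc h)) (fallingQ h k))
  where
  swap : ∀ a b c → a *ₚ (b *ₚ c) ≈ b *ₚ (a *ₚ c)
  swap = solve-∀ polyACR

fallingQ-above : ∀ {h k} → h < k → fallingQ h k ≈ 0ₚ
fallingQ-above {h} {suc k} (s≤s h≤k) rewrite ℕ.m≤n⇒m∸n≡0 h≤k = ≈-refl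

-- The Pascal rule arises from [h+1] = [k+1] + q^(k+1) [h-k], valid for k ≤ h; for k > h both sides
-- of `split` vanish together with `fallingQ h k`.
fallingQ-gauss : ∀ h k → fallingQ h k ≈ qfact k *ₚ gauss h k
fallingQ-gauss h       zero    = ≈-refl
fallingQ-gauss zero    (suc k) = ≈-trans (fallingQ-above {0} {suc k} (s≤s z≤n)) (≈-sym (*-zeroʳ (qfact (suc k))))
fallingQ-gauss (suc h) (suc k) = begin
  fallingQ (suc h) (suc k)
    ≈⟨ fallingQ-suc h k ⟩
  qint (suc h) *ₚ fallingQ h k
    ≈⟨ split (k ℕ.≤? h) ⟩
  (qint (suc k) +ₚ qpow (suc k) *ₚ qint (h ∸ k)) *ₚ fallingQ h k
    ≈⟨ distribute (qint (suc k)) (qpow (suc k)) (qint (h ∸ k)) (fallingQ h k) ⟩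
  qint (suc k) *ₚ fallingQ h k +ₚ qpow (suc k) *ₚ fallingQ h (suc k)
    ≈⟨ +-cong (*-congˡ (qint (suc k)) (fallingQ-gauss h k)) (*-cong (qpow-^ (suc k)) (fallingQ-gauss h (suc k))) ⟩
  qint (suc k) *ₚ (qfact k *ₚ gauss h k) +ₚ (qpow 1 ^ suc k) *ₚ (qfact (suc k) *ₚ gauss h (suc k))
    ≈⟨ collect (qint (suc k)) (qfact k) (gauss h k) (qpow 1 ^ suc k) (gauss h (suc k)) ⟩
  qfact (suc k) *ₚ gauss (suc h) (suc k) ∎
  where
  split : Dec (k ≤ h) → qint (suc h) *ₚ fallingQ h k ≈ (qint (suc k) +ₚ qpow (suc k) *ₚ qint (h ∸ k)) *ₚ fallingQ h k
  split (yes k≤h) = *-cong {r = fallingQ h k} (≈-trans (reflexive (≡.cong (λ i → qint (suc i)) (≡.sym (ℕ.m+[n∸m]≡n k≤h)))) (qint-+ (suc k) (h ∸ k))) ≈-refl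
  split (no k≰h) = ≈-trans (≈-trans (*-congˡ (qint (suc h)) z) (*-zeroʳ (qint (suc h))))
    (≈-sym (≈-trans (*-congˡ c z) (*-zeroʳ c)))
    where
    c = qint (suc k) +ₚ qpow (suc k) *ₚ qint (h ∸ k)
    z = fallingQ-above (ℕ.≰⇒> k≰h)
  distribute : ∀ a b c f → (a +ₚ b *ₚ c) *ₚ f ≈ a *ₚ f +ₚ b *ₚ (c *ₚ f)
  distribute = solve-∀ polyACR
  collect : ∀ a f g b g′ → a *ₚ (f *ₚ g) +ₚ b *ₚ ((a *ₚ f) *ₚ g′) ≈ (a *ₚ f) *ₚ (g +ₚ b *ₚ g′)
  collect = solve-∀ polyACR

Monic-1 : Monic 0 1ₚ
Monic-1 .lead          = ≡.refl
Monic-1 .above (suc i) _ = ≡.refl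

Monic-∷ : ∀ {d p} a → Monic d p → Monic (suc d) (a ∷ p)
Monic-∷ a M .lead                = lead M
Monic-∷ a M .above (suc i) (s≤s l) = above M i l

Monic-qint : ∀ m → Monic m (qint (suc m))
Monic-qint zero    = Monic-1
Monic-qint (suc m) = Monic-∷ (+ 1) (Monic-qint m)

Monic-qfact : ∀ k → ∃[ d ] Monic d (qfact k)
Monic-qfact zero    = 0 , Monic-1
Monic-qfact (suc k) with d , M ← Monic-qfact k = k ℕ.+ d , Monic-* (Monic-qint k) M

qbinom-gauss : ∀ h k → qbinom h k ≈ gauss h k
qbinom-gauss h k = quotₚ-exact (gauss h k) (proj₂ (Monic-qfact k)) (fallingQ-gauss h k)

sumTo-sum≤ : ∀ h {f g} → (∀ j → j ≤ h → f j ≈ g j) → sumTo h f ≈ sum≤ h g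
sumTo-sum≤ zero    e = e 0 z≤n
sumTo-sum≤ (suc h) e = +-cong (sumTo-sum≤ h (λ j l → e j (ℕ.m≤n⇒m≤1+n l))) (e (suc h) ℕ.≤-refl)

Dq-delannoy : ∀ h k → Dq h k ≈ delannoy k h
Dq-delannoy h k = sumTo-sum≤ h (λ j j≤h → *-cong
  (*-cong (qpow-^ (suc j C 2)) (qbinom-gauss k j))
  (≈-trans (qbinom-gauss (h ℕ.+ k ∸ j) k) (reflexive (≡.cong (λ i → gauss i k) (ℕ.+-∸-comm k j≤h)))))

-- Congruences

record Cong (P p r : Poly) : Set where
  constructor cong-by
  field
    factor : Poly
    ≈+*    : p ≈ r +ₚ P *ₚ factor

module _ {P : Poly} where

  ≈⇒Cong : ∀ {p r} → p ≈ r → Cong P p r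
  ≈⇒Cong {p} {r} e = cong-by [] (≈-trans e (≈-sym (≈-trans (+-cong {p = r} ≈-refl (*-zeroʳ P)) (+-identityʳ r))))

  Cong-sym : ∀ {p r} → Cong P p r → Cong P r p
  Cong-sym {p} {r} (cong-by c e) = cong-by (-ₚ c) (≈-trans (lemma r P c) (+-cong (≈-sym e) ≈-refl))
    where
    lemma : ∀ r P c → r ≈ (r +ₚ P *ₚ c) +ₚ P *ₚ (-ₚ c)
    lemma = solve-∀ polyACR

  Cong-trans : ∀ {p r s} → Cong P p r → Cong P r s → Cong P p s
  Cong-trans {p} {r} {s} (cong-by c e) (cong-by d f) = cong-by (d +ₚ c)
    (≈-trans e (≈-trans (+-cong f ≈-refl) (lemma s P c d)))
    where
    lemma : ∀ s P c d → (s +ₚ P *ₚ d) +ₚ P *ₚ c ≈ s +ₚ P *ₚ (d +ₚ c)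
    lemma = solve-∀ polyACR

  Cong-+ : ∀ {p p′ r r′} → Cong P p p′ → Cong P r r′ → Cong P (p +ₚ r) (p′ +ₚ r′)
  Cong-+ {p} {p′} {r} {r′} (cong-by c e) (cong-by d f) = cong-by (c +ₚ d) (≈-trans (+-cong e f) (lemma p′ r′ P c d))
    where
    lemma : ∀ p r P c d → (p +ₚ P *ₚ c) +ₚ (r +ₚ P *ₚ d) ≈ (p +ₚ r) +ₚ P *ₚ (c +ₚ d)
    lemma = solve-∀ polyACR

  Cong-* : ∀ {p p′ r r′} → Cong P p p′ → Cong P r r′ → Cong P (p *ₚ r) (p′ *ₚ r′)
  Cong-* {p} {p′} {r} {r′} (cong-by c e) (cong-by d f) =
    cong-by (c *ₚ r′ +ₚ p′ *ₚ d +ₚ c *ₚ P *ₚ d) (≈-trans (*-cong e f) (lemma p′ r′ P c d))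
    where
    lemma : ∀ p r P c d → (p +ₚ P *ₚ c) *ₚ (r +ₚ P *ₚ d) ≈ p *ₚ r +ₚ P *ₚ (c *ₚ r +ₚ p *ₚ d +ₚ c *ₚ P *ₚ d)
    lemma = solve-∀ polyACR

  Cong-neg : ∀ {p r} → Cong P p r → Cong P (-ₚ p) (-ₚ r)
  Cong-neg {p} {r} (cong-by c e) = cong-by (-ₚ c) (≈-trans (neg-cong e) (lemma r P c))
    where
    lemma : ∀ r P c → -ₚ (r +ₚ P *ₚ c) ≈ (-ₚ r) +ₚ P *ₚ (-ₚ c)
    lemma = solve-∀ polyACR

  Cong-refl : ∀ {p} → Cong P p p
  Cong-refl = ≈⇒Cong ≈-refl

  Cong-isEquivalence : IsEquivalence (Cong P)
  Cong-isEquivalence = record { refl = Cong-refl ; sym = Cong-sym ; trans = Cong-trans }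

-- Carrier and operations remain those of ℤ[q] and only equality is coarsened, so `Dq` itself serves
-- as a family of sequences in the quotient.
quotientRing : Poly → CommutativeRing 0ℓ 0ℓ
quotientRing P = record { isCommutativeRing = isCR }
  where
  module ℤ[q] = CommutativeRing polyRing
  isCR : IsCommutativeRing (Cong P) _+ₚ_ _*ₚ_ -ₚ_ 0ₚ 1ₚ
  isCR = record
    { isRing = record
      { +-isAbelianGroup = record
        { isGroup = record
          { isMonoid = record
            { isSemigroup = record
              { isMagma = record { isEquivalence = Cong-isEquivalence ; ∙-cong = Cong-+ }
              ; assoc = λ p r s → ≈⇒Cong (ℤ[q].+-assoc p r s) }
            ; identity = (λ p → ≈⇒Cong (ℤ[q].+-identityˡ p)) , λ p → ≈⇒Cong (ℤ[q].+-identityʳ p) }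
          ; inverse = (λ p → ≈⇒Cong (ℤ[q].-‿inverseˡ p)) , λ p → ≈⇒Cong (ℤ[q].-‿inverseʳ p)
          ; ⁻¹-cong = Cong-neg }
        ; comm = λ p r → ≈⇒Cong (ℤ[q].+-comm p r) }
      ; *-cong = Cong-*
      ; *-assoc = λ p r s → ≈⇒Cong (ℤ[q].*-assoc p r s)
      ; *-identity = (λ p → ≈⇒Cong (ℤ[q].*-identityˡ p)) , λ p → ≈⇒Cong (ℤ[q].*-identityʳ p)
      ; distrib = (λ p r s → ≈⇒Cong (ℤ[q].distribˡ p r s)) , λ p r s → ≈⇒Cong (ℤ[q].distribʳ p r s) }
    ; *-comm = λ p r → ≈⇒Cong (ℤ[q].*-comm p r) }

Cong⇒mod : ∀ {P p r} → Cong P p r → p ≡ r [modₚ P ]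
Cong⇒mod {P} {p} {r} (cong-by c e) = c , ≈0⇒IsZero _ (≈-trans (+-cong (+-cong {r = -ₚ r} e ≈-refl) ≈-refl) (lemma r P c))
  where
  lemma : ∀ r P c → ((r +ₚ P *ₚ c) -ₚ r) -ₚ P *ₚ c ≈ []
  lemma = solve-∀ polyACR

-- Cyclotomic polynomials

qpow-1 : ℕ → Poly
qpow-1 n = qpow n -ₚ 1ₚ

Monic-qpow-1 : ∀ n → Monic (suc n) (qpow-1 (suc n))
Monic-qpow-1 n = Monic-∷ _ (Monic-resp (≈-sym (+-identityʳ (qpow n))) (Monic-qpow n))
  where
  Monic-qpow : ∀ n → Monic n (qpow n)
  Monic-qpow zero    = Monic-1
  Monic-qpow (suc n) = Monic-∷ (+ 0) (Monic-qpow n)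

-- The sum 1 + q^g + ⋯ + q^((s-1)g).
geometric : ℕ → ℕ → Poly
geometric g zero    = 0ₚ
geometric g (suc s) = 1ₚ +ₚ qpow g *ₚ geometric g s

qpow-1-geometric : ∀ g s → qpow-1 (s ℕ.* g) ≈ qpow-1 g *ₚ geometric g s
qpow-1-geometric g zero    = ≈-trans 0∷[]≈0 (≈-sym (*-zeroʳ (qpow-1 g)))
qpow-1-geometric g (suc s) = begin
  qpow (g ℕ.+ s ℕ.* g) -ₚ 1ₚ
    ≈⟨ +-cong (qpow-+ g (s ℕ.* g)) ≈-refl ⟩
  qpow g *ₚ qpow (s ℕ.* g) -ₚ 1ₚ
    ≈⟨ split (qpow g) (qpow (s ℕ.* g)) ⟩
  (qpow g -ₚ 1ₚ) +ₚ qpow g *ₚ qpow-1 (s ℕ.* g)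
    ≈⟨ +-cong {p = qpow-1 g} ≈-refl (*-congˡ (qpow g) (qpow-1-geometric g s)) ⟩
  (qpow g -ₚ 1ₚ) +ₚ qpow g *ₚ (qpow-1 g *ₚ geometric g s)
    ≈⟨ collect (qpow g) (qpow-1 g) (geometric g s) ⟩
  qpow-1 g *ₚ (1ₚ +ₚ qpow g *ₚ geometric g s) ∎
  where
  split : ∀ a b → a *ₚ b -ₚ 1ₚ ≈ (a -ₚ 1ₚ) +ₚ a *ₚ (b -ₚ 1ₚ)
  split = solve-∀ polyACR
  collect : ∀ a b c → b +ₚ a *ₚ (b *ₚ c) ≈ b *ₚ (1ₚ +ₚ a *ₚ c)
  collect = solve-∀ polyACR

-- The exponents j with q^j c = c are closed under sums, multiples and differences, hence under gcd.
module Fixed (P c : Poly) where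
  Fixes : ℕ → Set
  Fixes j = Cong P (qpow j *ₚ c) c

  Fixes-+ : ∀ {i j} → Fixes i → Fixes j → Fixes (i ℕ.+ j)
  Fixes-+ {i} {j} e f = Cong-trans (≈⇒Cong (≈-trans (*-cong {r = c} (qpow-+ i j) ≈-refl) (*-assoc (qpow i) (qpow j) c)))
    (Cong-trans (Cong-* (Cong-refl {p = qpow i}) f) e)

  Fixes-* : ∀ {j} s → Fixes j → Fixes (s ℕ.* j)
  Fixes-* zero    e = ≈⇒Cong (*-identityˡ c)
  Fixes-* {j} (suc s) e = Fixes-+ {j} {s ℕ.* j} e (Fixes-* s e)

  -- q^g c = q^g (q^i c) = q^j c = c, which subtracts exponents without inverting q.
  Fixes-∸ : ∀ {g i j} → g ℕ.+ i ≡ j → Fixes i → Fixes j → Fixes g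
  Fixes-∸ {g} {i} ≡.refl e f = Cong-trans (Cong-* (Cong-refl {p = qpow g}) (Cong-sym e))
    (Cong-trans (≈⇒Cong (≈-sym (≈-trans (*-cong {r = c} (qpow-+ g i) ≈-refl) (*-assoc (qpow g) (qpow i) c)))) f)

  Fixes-bézout : ∀ {g i j} → Bézout.Identity g i j → Fixes i → Fixes j → Fixes g
  Fixes-bézout {g} {i} {j} (Bézout.+- x y e) fi fj = Fixes-∸ {g} {y ℕ.* j} {x ℕ.* i} e (Fixes-* {j} y fj) (Fixes-* {i} x fi)
  Fixes-bézout {g} {i} {j} (Bézout.-+ x y e) fi fj = Fixes-∸ {g} {x ℕ.* i} {y ℕ.* j} e (Fixes-* {i} x fi) (Fixes-* {j} y fj)

  Fixes-geometric : ∀ {g} → Fixes g → ∀ s → Cong P (geometric g s *ₚ c) (+ s ·ₚ c)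
  Fixes-geometric {g} e zero    = ≈⇒Cong (≈-sym (·-zeroˡ c))
  Fixes-geometric {g} e (suc s) =
    Cong-trans (≈⇒Cong (expand (qpow g) (geometric g s) c))
    (Cong-trans (Cong-+ (Cong-refl {p = c}) (Cong-trans (Cong-* (Cong-refl {p = geometric g s}) e) (Fixes-geometric {g} e s)))
    (≈⇒Cong (mk≈ coefficients)))
    where
    expand : ∀ a b c → (1ₚ +ₚ a *ₚ b) *ₚ c ≈ c +ₚ b *ₚ (a *ₚ c)
    expand = solve-∀ polyACR
    coefficients : ∀ i → coeff (c +ₚ + s ·ₚ c) i ≡ coeff (+ suc s ·ₚ c) i
    coefficients i rewrite coeff-+ c (+ s ·ₚ c) i | coeff-· (+ s) c i | coeff-· (+ suc s) c i = ≡.sym (ℤ.suc-* (+ s) (coeff c i))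

Cong0-*ʳ : ∀ {P p} r → Cong P p 0ₚ → Cong P (p *ₚ r) 0ₚ
Cong0-*ʳ r z = Cong-* z (Cong-refl {p = r})

fixed-difference : ∀ {P} j c → Cong P (qpow-1 j *ₚ c) 0ₚ → Cong P (qpow j *ₚ c) c
fixed-difference j c z = Cong-trans (≈⇒Cong (lemma (qpow j) c)) (Cong-+ z (Cong-refl {p = c}))
  where
  lemma : ∀ a c → a *ₚ c ≈ (a -ₚ 1ₚ) *ₚ c +ₚ c
  lemma = solve-∀ polyACR

multiple⇒Cong0 : ∀ P p → Cong P (P *ₚ p) 0ₚ
multiple⇒Cong0 P p = cong-by p ≈-refl

-- Any sequence satisfying the recursion that defines Φ; divisorProduct n d is
-- the product of the φ e over the e ≤ d that divide n.
module CyclotomicRecursion (φ : ℕ → Poly) (divisorProduct : ℕ → ℕ → Poly)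
  (φ-quotient : ∀ n → φ n ≡ quotₚ (qpow-1 n) (divisorProduct n (n ∸ 1)))
  (divisorProduct-0 : ∀ n → divisorProduct n 0 ≡ 1ₚ)
  (divisorProduct-∣ : ∀ n d → suc d < n → suc d ∣ n → divisorProduct n (suc d) ≡ φ (suc d) *ₚ divisorProduct n d)
  (divisorProduct-∤ : ∀ n d → ¬ suc d ∣ n → divisorProduct n (suc d) ≡ divisorProduct n d) where

  Regular : ℕ → Set
  Regular n = ∀ j c → 0 < j → j < n → Cong (φ n) (qpow j *ₚ c) c → Cong (φ n) c 0ₚ

  -- What the induction carries: `monic` permits division by products of the φ d, `product` trades φ
  -- d for q^d - 1, and `regular` acts as coprimality.
  record Cyclotomic (n : ℕ) : Set where
    field
      degree  : ℕ
      monic   : Monic degree (φ n)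
      product : qpow-1 n ≈ φ n *ₚ divisorProduct n (n ∸ 1)
      regular : Regular n
  open Cyclotomic public

  φ∣qpow-1 : ∀ {d n} → Cyclotomic d → d ∣ n → Cong (φ d) (qpow-1 n) 0ₚ
  φ∣qpow-1 {d} cyc (divides s ≡.refl) = Cong-trans
    (≈⇒Cong (≈-trans (qpow-1-geometric d s) (≈-trans (*-cong {r = geometric d s} (product cyc) ≈-refl) (*-assoc (φ d) _ (geometric d s)))))
    (multiple⇒Cong0 (φ d) _)

  divisorProduct-0-* : ∀ n p → divisorProduct n 0 *ₚ p ≈ p
  divisorProduct-0-* n p = ≈-trans (reflexive (≡.cong (_*ₚ p) (divisorProduct-0 n))) (*-identityˡ p)

  module CyclotomicStep (m : ℕ) (IH : ∀ d → suc d < suc m → Cyclotomic (suc d)) where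
    n = suc m

    Monic-divisorProduct : ∀ e → e < n → ∃[ d ] Monic d (divisorProduct n e)
    Monic-divisorProduct zero    _   = 0 , ≡.subst (Monic 0) (≡.sym (divisorProduct-0 n)) Monic-1
    Monic-divisorProduct (suc e) e<n with d , M ← Monic-divisorProduct e (ℕ.<-trans (ℕ.n<1+n e) e<n) with suc e ∣? n
    ... | yes e∣n = degree (IH e e<n) ℕ.+ d
                  , ≡.subst (Monic _) (≡.sym (divisorProduct-∣ n e e<n e∣n)) (Monic-* (monic (IH e e<n)) M)
    ... | no e∤n  = d , ≡.subst (Monic d) (≡.sym (divisorProduct-∤ n e e∤n)) M

    -- Each factor φ e has e < f + 1 and divides q^e - 1. Whatever it annihilates modulo φ (f + 1)
    -- is annihilated by q^e - 1 too, hence zero by regularity.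
    divisorProduct-regular : ∀ f → suc f < n → ∀ d → d ≤ f → ∀ c →
      Cong (φ (suc f)) (divisorProduct n d *ₚ c) 0ₚ → Cong (φ (suc f)) c 0ₚ
    divisorProduct-regular f f<n zero    _   c z = Cong-trans (≈⇒Cong (≈-sym (divisorProduct-0-* n c))) z
    divisorProduct-regular f f<n (suc d) d<f c z with suc d ∣? n
    ... | no d∤n  = divisorProduct-regular f f<n d (ℕ.<⇒≤ d<f) c
                      (≡.subst (λ p → Cong (φ (suc f)) (p *ₚ c) 0ₚ) (divisorProduct-∤ n d d∤n) z)
    ... | yes d∣n = divisorProduct-regular f f<n d (ℕ.<⇒≤ d<f) c
        (regular (IH f f<n) (suc d) (divisorProduct n d *ₚ c) (s≤s z≤n) (s≤s d<f)
          (fixed-difference (suc d) _ (Cong-trans (≈⇒Cong rearranged) (Cong0-*ʳ (divisorProduct (suc d) d) z))))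
      where
      d<n = ℕ.<-trans (s≤s d<f) f<n
      swap : ∀ a b p c → (a *ₚ b) *ₚ (p *ₚ c) ≈ ((a *ₚ p) *ₚ c) *ₚ b
      swap = solve-∀ polyACR
      rearranged : qpow-1 (suc d) *ₚ (divisorProduct n d *ₚ c) ≈ (divisorProduct n (suc d) *ₚ c) *ₚ divisorProduct (suc d) d
      rearranged = ≈-trans (*-cong {r = divisorProduct n d *ₚ c} (product (IH d d<n)) ≈-refl)
        (≈-trans (swap (φ (suc d)) (divisorProduct (suc d) d) (divisorProduct n d) c)
          (reflexive (≡.cong (λ p → (p *ₚ c) *ₚ divisorProduct (suc d) d) (≡.sym (divisorProduct-∣ n d d<n d∣n)))))

    -- Factors are added in increasing order: φ (e + 1) divides q^n - 1 = `divisorProduct n e` · s,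
    -- and as the first factor is regular modulo it, it divides s.
    divisorProduct-divides : ∀ e → e < n → ∃[ s ] qpow-1 n ≈ divisorProduct n e *ₚ s
    divisorProduct-divides zero    _   = qpow-1 n , ≈-sym (divisorProduct-0-* n (qpow-1 n))
    divisorProduct-divides (suc e) e<n with s , s≈ ← divisorProduct-divides e (ℕ.<-trans (ℕ.n<1+n e) e<n) with suc e ∣? n
    ... | no e∤n  = s , ≈-trans s≈ (reflexive (≡.cong (_*ₚ s) (≡.sym (divisorProduct-∤ n e e∤n))))
    ... | yes e∣n with cong-by t t≈ ← divisorProduct-regular e e<n e ℕ.≤-refl s (Cong-trans (≈⇒Cong (≈-sym s≈)) (φ∣qpow-1 (IH e e<n) e∣n))
        = t , (begin
          qpow-1 n                                   ≈⟨ s≈ ⟩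
          divisorProduct n e *ₚ s                    ≈⟨ *-congˡ (divisorProduct n e) t≈ ⟩
          divisorProduct n e *ₚ (φ (suc e) *ₚ t)     ≈⟨ swap (divisorProduct n e) (φ (suc e)) t ⟩
          (φ (suc e) *ₚ divisorProduct n e) *ₚ t     ≡⟨ ≡.cong (_*ₚ t) (divisorProduct-∣ n e e<n e∣n) ⟨
          divisorProduct n (suc e) *ₚ t ∎)
        where
        swap : ∀ a b c → a *ₚ (b *ₚ c) ≈ (b *ₚ a) *ₚ c
        swap = solve-∀ polyACR

    φ-product : qpow-1 n ≈ divisorProduct n m *ₚ φ n
    φ-product with s , s≈ ← divisorProduct-divides m ℕ.≤-refl = ≈-trans s≈ (*-congˡ (divisorProduct n m) (≈-sym
      (≈-trans (reflexive (φ-quotient n)) (quotₚ-exact s (proj₂ (Monic-divisorProduct m ℕ.≤-refl)) s≈))))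

    φ-monic : ∃[ d ] Monic d (φ n)
    φ-monic with d , M ← Monic-divisorProduct m ℕ.≤-refl = n ∸ d
      , Monic-cofactor M (n ∸ d) (φ n) (≡.subst (λ i → Monic i (divisorProduct n m *ₚ φ n)) (≡.sym (ℕ.m+[n∸m]≡n d≤n)) N)
      where
      N : Monic n (divisorProduct n m *ₚ φ n)
      N = Monic-resp φ-product (Monic-qpow-1 m)
      d≤n : d ≤ n
      d≤n = Monic-cofactor-degree (φ n) M N

    divisorProduct-mono : ∀ d t → d ℕ.+ t < n → ∃[ s ] divisorProduct n (d ℕ.+ t) ≈ divisorProduct n d *ₚ s
    divisorProduct-mono d zero    _ = 1ₚ , ≈-trans (reflexive (≡.cong (divisorProduct n) (ℕ.+-identityʳ d)))
      (≈-sym (≈-trans (*-comm (divisorProduct n d) 1ₚ) (*-identityˡ (divisorProduct n d))))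
    divisorProduct-mono d (suc t) l rewrite ℕ.+-suc d t
      with s , s≈ ← divisorProduct-mono d t (ℕ.<-trans (ℕ.n<1+n _) l) with suc (d ℕ.+ t) ∣? n
    ... | no ∤n  = s , ≈-trans (reflexive (divisorProduct-∤ n (d ℕ.+ t) ∤n)) s≈
    ... | yes ∣n = φ (suc (d ℕ.+ t)) *ₚ s , ≈-trans (reflexive (divisorProduct-∣ n (d ℕ.+ t) l ∣n))
        (≈-trans (*-congˡ (φ (suc (d ℕ.+ t))) s≈) (swap (φ (suc (d ℕ.+ t))) (divisorProduct n d) s))
        where
        swap : ∀ a b c → a *ₚ (b *ₚ c) ≈ b *ₚ (a *ₚ c)
        swap = solve-∀ polyACR

    -- Divisors of g divide n, so each factor on the g side recurs on the n side.
    divisorProduct-sub : ∀ g → g < n → g ∣ n → ∀ d → d < g → ∃[ s ] divisorProduct n d ≈ divisorProduct g d *ₚ s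
    divisorProduct-sub g g<n g∣n zero    _   = 1ₚ , ≈-trans (reflexive (divisorProduct-0 n)) (≈-sym (divisorProduct-0-* g 1ₚ))
    divisorProduct-sub g g<n g∣n (suc d) d<g
      with s , s≈ ← divisorProduct-sub g g<n g∣n d (ℕ.<-trans (ℕ.n<1+n d) d<g) with suc d ∣? g | suc d ∣? n
    ... | yes d∣g | no d∤n  = ⊥-elim (d∤n (∣-trans d∣g g∣n))
    ... | no d∤g  | no d∤n  = s , ≈-trans (reflexive (divisorProduct-∤ n d d∤n))
        (≈-trans s≈ (reflexive (≡.cong (_*ₚ s) (≡.sym (divisorProduct-∤ g d d∤g)))))
    ... | no d∤g  | yes d∣n = φ (suc d) *ₚ s , ≈-trans (reflexive (divisorProduct-∣ n d (ℕ.<-trans d<g g<n) d∣n))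
        (≈-trans (*-congˡ (φ (suc d)) s≈) (≈-trans (swap (φ (suc d)) (divisorProduct g d) s)
          (reflexive (≡.cong (_*ₚ (φ (suc d) *ₚ s)) (≡.sym (divisorProduct-∤ g d d∤g))))))
        where
        swap : ∀ a b c → a *ₚ (b *ₚ c) ≈ b *ₚ (a *ₚ c)
        swap = solve-∀ polyACR
    ... | yes d∣g | yes d∣n = s , ≈-trans (reflexive (divisorProduct-∣ n d (ℕ.<-trans d<g g<n) d∣n))
        (≈-trans (*-congˡ (φ (suc d)) s≈) (≈-trans (≈-sym (*-assoc (φ (suc d)) (divisorProduct g d) s))
          (reflexive (≡.cong (_*ₚ s) (≡.sym (divisorProduct-∣ g d d<g d∣g))))))

    -- The divisors of g + 1 are proper divisors of n, and the φ at these divisors multiply to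
    -- q^(g+1) - 1 by induction.
    qpow-1∣divisorProduct : ∀ g → suc g < n → suc g ∣ n → ∃[ s ] divisorProduct n m ≈ qpow-1 (suc g) *ₚ s
    qpow-1∣divisorProduct g g<n g∣n
      with s , s≈ ← divisorProduct-mono (suc g) (m ∸ suc g) (≡.subst (_< n) (≡.sym (ℕ.m+[n∸m]≡n (ℕ.≤-pred g<n))) ℕ.≤-refl)
      with t , t≈ ← divisorProduct-sub (suc g) g<n g∣n g ℕ.≤-refl
      = t *ₚ s , (begin
        divisorProduct n m
          ≡⟨ ≡.cong (divisorProduct n) (ℕ.m+[n∸m]≡n (ℕ.≤-pred g<n)) ⟨
        divisorProduct n (suc g ℕ.+ (m ∸ suc g))
          ≈⟨ s≈ ⟩
        divisorProduct n (suc g) *ₚ s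
          ≡⟨ ≡.cong (_*ₚ s) (divisorProduct-∣ n g g<n g∣n) ⟩
        (φ (suc g) *ₚ divisorProduct n g) *ₚ s
          ≈⟨ *-cong {r = s} (*-congˡ (φ (suc g)) t≈) ≈-refl ⟩
        (φ (suc g) *ₚ (divisorProduct (suc g) g *ₚ t)) *ₚ s
          ≈⟨ regroup (φ (suc g)) (divisorProduct (suc g) g) t s ⟩
        (φ (suc g) *ₚ divisorProduct (suc g) g) *ₚ (t *ₚ s)
          ≈⟨ *-cong {r = t *ₚ s} (≈-sym (product (IH g g<n))) ≈-refl ⟩
        qpow-1 (suc g) *ₚ (t *ₚ s) ∎)
      where
      regroup : ∀ a b t s → (a *ₚ (b *ₚ t)) *ₚ s ≈ (a *ₚ b) *ₚ (t *ₚ s)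
      regroup = solve-∀ polyACR

    -- In q^n - 1 = `divisorProduct n m` · φ n the first factor contains the monic polynomial
    -- q^(g+1) - 1, which cancels.
    φ∣geometric : ∀ g s → n ≡ s ℕ.* suc g → suc g < n → Cong (φ n) (geometric (suc g) s) 0ₚ
    φ∣geometric g s n≡ g<n = cong-by t (Monic-cancel (Monic-qpow-1 g) (geometric (suc g) s) (φ n *ₚ t) (begin
      qpow-1 (suc g) *ₚ geometric (suc g) s  ≈⟨ qpow-1-geometric (suc g) s ⟨
      qpow-1 (s ℕ.* suc g)                   ≈⟨ reflexive (≡.cong qpow-1 n≡) ⟨
      qpow-1 n                               ≈⟨ φ-product ⟩
      divisorProduct n m *ₚ φ n              ≈⟨ *-cong {r = φ n} (proj₂ factored) ≈-refl ⟩
      (qpow-1 (suc g) *ₚ t) *ₚ φ n           ≈⟨ swap (qpow-1 (suc g)) t (φ n) ⟩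
      qpow-1 (suc g) *ₚ (φ n *ₚ t) ∎))
      where
      factored = qpow-1∣divisorProduct g g<n (divides s n≡)
      t = proj₁ factored
      swap : ∀ a b c → (a *ₚ b) *ₚ c ≈ a *ₚ (c *ₚ b)
      swap = solve-∀ polyACR

    φ∣qpow-1-self : Cong (φ n) (qpow-1 n) 0ₚ
    φ∣qpow-1-self = Cong-trans (≈⇒Cong (≈-trans φ-product (*-comm (divisorProduct n m) (φ n)))) (multiple⇒Cong0 (φ n) _)

    -- If q^j and q^n = 1 both fix c, so does q^g for g = gcd j n, and then
    -- 0 = (1 + q^g + ⋯ + q^(n−g)) c = (n/g) c.
    φ-regular : Regular n
    φ-regular j c 0<j j<n fixed with Bézout.lemma j n
    ... | Bézout.result zero gcd _ = ⊥-elim (ℕ.<⇒≢ 0<j (≡.sym (0∣⇒≡0 (proj₁ (GCD.commonDivisor gcd)))))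
    ... | Bézout.result (suc g) gcd identity with divides s n≡ ← proj₂ (GCD.commonDivisor gcd) =
        cong-by (proj₁ torsion) (proj₂ torsion)
      where
      open Fixed (φ n) c
      g<n : suc g < n
      g<n = ℕ.≤-<-trans (∣⇒≤ {{ℕ.>-nonZero 0<j}} (proj₁ (GCD.commonDivisor gcd))) j<n
      fixes-n : Fixes n
      fixes-n = fixed-difference n c (Cong0-*ʳ c φ∣qpow-1-self)
      fixes-g : Fixes (suc g)
      fixes-g = Fixes-bézout {suc g} {j} {n} identity fixed fixes-n
      s·c : Cong (φ n) (+ s ·ₚ c) 0ₚ
      s·c = Cong-trans (Cong-sym (Fixes-geometric {suc g} fixes-g s)) (Cong0-*ʳ c (φ∣geometric g s n≡ g<n))
      s≢0 : + s ≢ + 0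
      s≢0 e = ℕ.1+n≢0 (≡.trans n≡ (≡.cong (ℕ._* suc g) (ℤ.+-injective e)))
      -- Monicity of φ n allows the nonzero integer s to be cancelled.
      torsion : ∃[ t ] c ≈ φ n *ₚ t
      torsion = Monic-torsion-free (proj₂ φ-monic) (+ s) s≢0 c (Cong.factor s·c) (Cong.≈+* s·c)

    cyclotomic-step : Cyclotomic n
    cyclotomic-step = record
      { degree  = proj₁ φ-monic
      ; monic   = proj₂ φ-monic
      ; product = ≈-trans φ-product (*-comm (divisorProduct n m) (φ n))
      ; regular = φ-regular }

  cyclotomic : ∀ n → Cyclotomic (suc n)
  cyclotomic = <-rec _ (λ m IH → CyclotomicStep.cyclotomic-step m (λ { d (s≤s d<m) → IH d<m }))

-- The table of cyclotomic polynomials behind `Φ`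

mutual
  divisorProduct : ℕ → ℕ → Poly
  divisorProduct = _

  Φ-quotient : ∀ n → Φ n ≡ quotₚ (qpow n -ₚ 1ₚ) (divisorProduct n (n ∸ 1))
  Φ-quotient n with n ∸ 1 | reverse {A = ℤ}
  ... | d | rev = ≡.refl

divisorProduct-∤ : ∀ n d → ¬ suc d ∣ n → divisorProduct n (suc d) ≡ divisorProduct n d
divisorProduct-∤ n d d∤n with suc d ∣? n
... | no _    = ≡.refl
... | yes d∣n = ⊥-elim (d∤n d∣n)

mutual
  entry : ℕ → ℕ → Poly
  entry = _

  divisorProduct-entry : ∀ n d → suc d ∣ n → divisorProduct n (suc d) ≡ entry n d *ₚ divisorProduct n d
  divisorProduct-entry n d d∣n with suc d ∣? n
  ... | no d∤n = ⊥-elim (d∤n d∣n)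
  -- With `_*ₚ_` turned into a variable the product is rigid, and the unifier can read off its left
  -- factor.
  ... | yes _ with _*ₚ_
  ...   | _*_ = ≡.refl

-- Generalising entry over _++_ exposes list lookup, and with it the list of
-- the Φ d for d < n, as unification variables that can be solved.
mutual
  entry′ : ℕ → (List Poly → List Poly → List Poly) → ℕ → Poly
  entry′ = _

  entry-++ : ∀ n d → entry (suc n) d ≡ entry′ n _++_ d
  entry-++ n d with _++_ {A = Poly}
  ... | _⊕_ = ≡.refl

-- `entry′ 0 _⊕_ d` looks up position d + 1 in a list built by `_⊕_`. The constant operation
-- supplies an arbitrary list there, and the dummy head absorbs the offset.
nth : List Poly → ℕ → Poly
nth ps = entry′ 0 (λ _ _ → 1ₚ ∷ ps)

mutual
  Φ-table : ℕ → List Poly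
  Φ-table = _

  entry-table : ∀ n d → entry (suc n) d ≡ nth (Φ-table n ++ [ Φ n ]) (suc d)
  entry-table n d with _++_ {A = Poly}
  ... | _⊕_ = ≡.refl

length-Φ-table : ∀ n → length (Φ-table n) ≡ n
length-Φ-table zero    = ≡.refl
length-Φ-table (suc n) = ≡.trans (length-++ (Φ-table n)) (≡.trans (ℕ.+-comm (length (Φ-table n)) 1) (≡.cong suc (length-Φ-table n)))

nth-++ˡ : ∀ ps rs i → i < length ps → nth (ps ++ rs) i ≡ nth ps i
nth-++ˡ (p ∷ ps) rs zero    _       = ≡.refl
nth-++ˡ (p ∷ ps) rs (suc i) (s≤s l) = nth-++ˡ ps rs i l

nth-snoc : ∀ ps p → nth (ps ++ [ p ]) (length ps) ≡ p
nth-snoc []       p = ≡.refl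
nth-snoc (_ ∷ ps) p = nth-snoc ps p

nth-Φ-table : ∀ n i → i < n → nth (Φ-table n) i ≡ Φ i
nth-Φ-table (suc n) i (s≤s i≤n) with ℕ.m≤n⇒m<n∨m≡n i≤n
... | inj₁ i<n    = ≡.trans (nth-++ˡ (Φ-table n) _ i (≡.subst (i <_) (≡.sym (length-Φ-table n)) i<n)) (nth-Φ-table n i i<n)
... | inj₂ ≡.refl = ≡.trans (≡.cong (nth (Φ-table (suc n))) (≡.sym (length-Φ-table n))) (nth-snoc (Φ-table n) (Φ n))

-- The bound d + 1 < n keeps the lookup inside the table, beyond which it returns the default 1.
divisorProduct-∣ : ∀ n d → suc d < n → suc d ∣ n → divisorProduct n (suc d) ≡ Φ (suc d) *ₚ divisorProduct n d
divisorProduct-∣ (suc n) d d<n d∣n = ≡.trans (divisorProduct-entry (suc n) d d∣n)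
  (≡.cong (_*ₚ divisorProduct (suc n) d) (nth-Φ-table (suc n) (suc d) d<n))

open CyclotomicRecursion Φ divisorProduct Φ-quotient (λ _ → ≡.refl) divisorProduct-∣ divisorProduct-∤ using (regular; φ∣qpow-1; cyclotomic)

-- The congruences for the q-Delannoy numbers

module _ (P : Poly) where
  private module ℤ[q]/P = CommutativeRing (quotientRing P)
  open Algebra.Properties.CommutativeSemiring.Exp ℤ[q]/P.commutativeSemiring using () renaming (_^_ to _^ᶜ_)

  -- The ring is a parameter of `_^_`, so powers in ℤ[q] and in its quotient agree by induction on
  -- the exponent and not by computation.
  ^ᶜ-^ : ∀ p n → p ^ᶜ n ≡ p ^ n
  ^ᶜ-^ p zero    = ≡.refl
  ^ᶜ-^ p (suc n) = ≡.cong (p *ₚ_) (^ᶜ-^ p n)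

  qpow-^ᶜ : ∀ n → qpow n ≈ qpow 1 ^ᶜ n
  qpow-^ᶜ n = ≈-trans (qpow-^ n) (reflexive (≡.sym (^ᶜ-^ (qpow 1) n)))

  Dq-step : ∀ k h → Cong P (Sequences.step (quotientRing P) (-ₚ (qpow 1 ^ᶜ suc k)) (λ h → Dq h (suc k)) h)
                           (Sequences.step (quotientRing P) (qpow 1 ^ᶜ suc k) (λ h → Dq h k) h)
  Dq-step k h rewrite ^ᶜ-^ (qpow 1) k = ≈⇒Cong (≈-trans (to h) (≈-trans (delannoy-step k h) (≈-sym (from h))))
    where
    q^ = qpow 1 *ₚ (qpow 1 ^ k)
    to : ∀ h → Sequences.step (quotientRing P) (-ₚ q^) (λ h → Dq h (suc k)) h ≈ step (-ₚ q^) (delannoy (suc k)) h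
    to zero    = +-cong (Dq-delannoy 0 (suc k)) ≈-refl
    to (suc h) = +-cong (Dq-delannoy (suc h) (suc k)) (*-congˡ (-ₚ q^) (Dq-delannoy h (suc k)))
    from : ∀ h → Sequences.step (quotientRing P) q^ (λ h → Dq h k) h ≈ step q^ (delannoy k) h
    from zero    = +-cong (Dq-delannoy 0 k) ≈-refl
    from (suc h) = +-cong (Dq-delannoy (suc h) k) (*-congˡ q^ (Dq-delannoy h k))

  module DelannoyCongruence (n : ℕ) (0<n : 0 < n) (qⁿ≡1 : Cong P (qpow n) 1ₚ)
    (fixed⇒0 : ∀ j c → 0 < j → j < n → Cong P (qpow j *ₚ c) c → Cong P c 0ₚ) where

    open GaussianBinomials.RootOfUnity (quotientRing P) (qpow 1) (λ k h → Dq h k) Dq-step n 0<n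
      (Cong-trans (≈⇒Cong (≈-sym (qpow-^ᶜ n))) qⁿ≡1)
      (λ j c 0<j j<n fixed → fixed⇒0 j c 0<j j<n (Cong-trans (≈⇒Cong (*-cong {r = c} (qpow-^ᶜ j) ≈-refl)) fixed))
      public using (odd-case; even-case)

qⁿ≡1 : ∀ m → Cong (Φ (suc m)) (qpow (suc m)) 1ₚ
qⁿ≡1 m = Cong-trans (≈⇒Cong (lemma (qpow (suc m)))) (Cong-+ (φ∣qpow-1 (cyclotomic m) ∣-refl) (Cong-refl {p = 1ₚ}))
  where
  lemma : ∀ p → p ≈ (p -ₚ 1ₚ) +ₚ 1ₚ
  lemma = solve-∀ polyACR

open import Data.Nat using (_+_; _*_; _%_; _/_)

theorem1p2 : (n h k : ℕ) → 1 ≤ n →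
    (n % 2 ≡ 1 → Dq (h + n) (k + n) ≡ Dq (h + n) k +ₚ Dq h (k + n) +ₚ Dq h k [modₚ Φ n ])
    × (n % 2 ≡ 0 → Dq (h + n) (k + n) ≡ Dq (h + n) k +ₚ Dq h (k + n) -ₚ Dq h k [modₚ Φ n ])
theorem1p2 n@(suc m) h k _ =
    (λ odd → Cong⇒mod (odd-case (n / 2) (≡.trans n≡ (≡.cong (_+ n / 2 * 2) odd)) h k))
  , (λ even → Cong⇒mod (even-case (n / 2) (≡.trans n≡ (≡.cong (_+ n / 2 * 2) even)) h k))
  where
  open DelannoyCongruence (Φ n) n (s≤s z≤n) (qⁿ≡1 m) (regular (cyclotomic m))
  n≡ = m≡m%n+[m/n]*n n 2
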